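{- Let $G$ and $H$ be connected graphs such that $G_{SR}$ and $H_{SR}$ are vertex-transitive. Then $$\dim_s(G\Box H)=\min\{|\partial(G)|\dim_s(H),\ |\partial(H)|\dim_s(G)\}.$$
   Context: All graphs are finite and simple. For a connected graph $G$, $d_G$ is the shortest-path distance and $I_G[u,v]$ is the set of vertices on some shortest $u$–$v$ path. A vertex $w$ strongly resolves $u,v$ if $v\in I_G[u,w]$ or $u\in I_G[v,w]$. A strong resolving set is a set $S\subseteq V(G)$ such that every pair of vertices is strongly resolved by some vertex of $S$; $\dim_s(G)$ is the minimum size of one. A vertex $u$ is maximally distant from $v$ if $d_G(v,w)\le d_G(u,v)$ for every neighbor $w$ of $u$; $u,v$ are mutually maximally distant if each is maximally distant from the other. The boundary $\partial(G)$ is the set of vertices $u$ for which some $v$ exists with $u,v$ mutually maximally distant. The strong resolving graph $G_{SR}$ has vertex set $\partial(G)$, two vertices adjacent iff mutually maximally distant in $G$. $G\Box H$ is the Cartesian product: vertex set $V(G)\times V(H)$, $(a,b)\sim(c,d)$ iff ($a=c$ and $bd\in E(H)$) or ($b=d$ and $ac\in E(G)$).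
   Formalization: G and H are assumed to have at least two vertices; with H a single vertex and G = K2 the formula as stated gives 0, while the strong metric dimension of the product is 1. -}

module Defs where

open import Data.Nat using (ℕ; zero; suc; _+_; _*_; _≤_; _≤ᵇ_)
open import Data.Bool using (Bool; true; false; _∧_; _∨_; not; if_then_else_)
open import Data.Fin using (Fin; remQuot; _≟_)
open import Data.Fin.Subset using (Subset; _∈_; ∣_∣)
open import Data.List using (List; filterᵇ; length; allFin)
open import Data.Bool.ListAction using (any; all)
open import Data.Product using (_×_; _,_; Σ; ∃)
open import Data.Sum using (_⊎_)
open import Relation.Nullary using (¬_)
open import Relation.Nullary.Decidable using (⌊_⌋)
open import Relation.Binary.PropositionalEquality using (_≡_; _≢_)

record Graph : Set where
  constructor mkGraph
  field
    n   : ℕ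
    adj : Fin n → Fin n → Bool
open Graph public

V : Graph → Set
V G = Fin (n G)

IsSimple : Graph → Set
IsSimple G = (∀ u v → adj G u v ≡ adj G v u) × (∀ u → adj G u u ≡ false)

reach : (G : Graph) → ℕ → V G → V G → Bool
reach G zero    u v = ⌊ u ≟ v ⌋
reach G (suc k) u v = reach G k u v ∨ any (λ w → reach G k u w ∧ adj G w v) (allFin (n G))

Connected : Graph → Set
Connected G = ∀ u v → Σ ℕ λ k → reach G k u v ≡ true

private
  search : (G : Graph) → V G → V G → ℕ → ℕ → ℕ
  search G u v k zero       = k
  search G u v k (suc fuel) = if reach G k u v then k else search G u v (suc k) fuel

-- shortest-path distance d_G(u,v): the least k such that a u–v walk of length ≤ k exists
-- (a walk of length ≤ n−1 exists whenever u,v are connected, so searching k ≤ n suffices)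
dist : (G : Graph) → V G → V G → ℕ
dist G u v = search G u v 0 (suc (n G))

InInterval : (G : Graph) → V G → V G → V G → Set
InInterval G x u w = dist G u x + dist G x w ≡ dist G u w

StronglyResolves : (G : Graph) → V G → V G → V G → Set
StronglyResolves G w u v = InInterval G v u w ⊎ InInterval G u v w

IsStrongResolvingSet : (G : Graph) → Subset (n G) → Set
IsStrongResolvingSet G S =
  ∀ u v → u ≢ v → Σ (V G) λ w → (w ∈ S) × StronglyResolves G w u v

IsStrongMetricDim : Graph → ℕ → Set
IsStrongMetricDim G k =
  (Σ (Subset (n G)) λ S → IsStrongResolvingSet G S × ∣ S ∣ ≡ k)
  × (∀ S → IsStrongResolvingSet G S → k ≤ ∣ S ∣)

maxDist : (G : Graph) → V G → V G → Bool
maxDist G u v = all (λ w → not (adj G u w) ∨ (dist G v w ≤ᵇ dist G u v)) (allFin (n G))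

mutMaxDist : (G : Graph) → V G → V G → Bool
mutMaxDist G u v = maxDist G u v ∧ maxDist G v u

inBoundary : (G : Graph) → V G → Bool
inBoundary G u = any (λ v → mutMaxDist G u v) (allFin (n G))

boundarySize : Graph → ℕ
boundarySize G = length (filterᵇ (inBoundary G) (allFin (n G)))

-- G_SR is vertex-transitive: for all x, y ∈ ∂(G) there is an automorphism of G_SR
-- (a bijection φ of ∂(G), inverse ψ, preserving and reflecting adjacency = mutual
-- maximal distance) with φ x = y.
SRVertexTransitive : Graph → Set
SRVertexTransitive G =
  ∀ x y → inBoundary G x ≡ true → inBoundary G y ≡ true →
  Σ (V G → V G) λ φ → Σ (V G → V G) λ ψ →
    (∀ u → inBoundary G u ≡ true → inBoundary G (φ u) ≡ true) ×
    (∀ u → inBoundary G u ≡ true → inBoundary G (ψ u) ≡ true) ×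
    (∀ u → inBoundary G u ≡ true → ψ (φ u) ≡ u) ×
    (∀ u → inBoundary G u ≡ true → φ (ψ u) ≡ u) ×
    (∀ u v → inBoundary G u ≡ true → inBoundary G v ≡ true →
       mutMaxDist G (φ u) (φ v) ≡ mutMaxDist G u v) ×
    (φ x ≡ y)

_□_ : Graph → Graph → Graph
G □ H = mkGraph (n G * n H) λ i j → prodAdj (remQuot (n H) i) (remQuot (n H) j)
  where
  prodAdj : V G × V H → V G × V H → Bool
  prodAdj (a , b) (c , d) = (⌊ a ≟ c ⌋ ∧ adj H b d) ∨ (⌊ b ≟ d ⌋ ∧ adj G a c)

{-# OPTIONS --safe #-}
module Submission where

-- A vertex v lying on a shortest u–w path and maximally distant from u must be w, and every
-- shortest path extends to one between mutually maximally distant vertices; so strong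
-- resolving sets are the vertex covers of G_SR, and dim_s(G) = |∂(G)| − α(G_SR). Distances add
-- in G □ H, so (G □ H)_SR is the direct product of G_SR and H_SR, and what remains is Zhang's
-- formula for the independence number of a direct product of vertex-transitive graphs.
-- Let S be independent in the product. A vertex of S cannot have neighbours in S both along
-- its row and along its column, since these two would be adjacent. Let I be the vertices of S
-- isolated in their row and K the others, which are isolated in their column. The closed
-- neighbourhoods of I (taken in rows) and of K (taken in columns) are disjoint, and in a
-- vertex-transitive graph |A| / |N[A]| ≤ α / |V| for every independent set A.
open import Defs
open import Data.Nat using (ℕ; zero; suc; _+_; _*_; _^_; _⊓_; _⊔_; _≤_; _≤?_; NonZero; z≤n; s≤s; >-nonZero)
open import Data.Nat.Properties hiding (_≟_)
open import Data.Nat.Tactic.RingSolver using (solve-∀)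
open import Data.Bool using (Bool; true; false; _∧_; _∨_; not; if_then_else_)
import Data.Bool.Properties as Bool
open import Data.Bool.ListAction using (any; all)
open import Data.Fin using (Fin; zero; suc; toℕ; combine; remQuot; finToFun; funToFin; _↑ˡ_; _↑ʳ_)
open import Data.Fin.Properties using (_≟_; any?; all?; toℕ-injective; toℕ<n; injective⇒≤; remQuot-combine; combine-remQuot; finToFun-funToFin; funToFin-finToFin)
open import Data.Fin.Permutation using (Permutation′; permutation; _⟨$⟩ʳ_; _⟨$⟩ˡ_; inverseˡ; inverseʳ)
open import Data.Fin.Subset using (Subset; _∈_; ∣_∣)
open import Data.Fin.Subset.Properties using (_∈?_)
open import Data.List using (allFin; filterᵇ; length; tabulate)
open import Data.List.Membership.Propositional using (lose)
open import Data.List.Membership.Propositional.Properties using (∈-allFin)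
import Data.List.Relation.Unary.Any as Any
import Data.List.Relation.Unary.Any.Properties as Any
import Data.List.Relation.Unary.All as All
import Data.List.Relation.Unary.All.Properties as All
open import Data.Product using (_×_; _,_; Σ; ∃; proj₁; proj₂)
open import Data.Sum using (_⊎_; inj₁; inj₂)
import Data.Vec as Vec
import Data.Vec.Properties as Vec
open import Function using (_∘_; id; Equivalence; mk⇔)
open import Level using (0ℓ)
open import Relation.Nullary using (¬_; Dec; yes; no; does; contradiction)
open import Relation.Nullary.Decidable using (⌊_⌋; _×-dec_; _⊎-dec_; _→-dec_; ¬?; dec-true)
open import Relation.Unary using (Pred; Decidable)
import Relation.Binary as B
open import Relation.Binary.PropositionalEquality using (_≡_; _≢_; _≗_; refl; sym; trans; cong; cong₂; subst; subst₂; module ≡-Reasoning)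
open import Algebra.Properties.Semiring.Sum +-*-semiring using (sum; sum-cong-≗; ∑-distrib-+; ∑-comm; sum-permute; *-distribˡ-sum; *-distribʳ-sum)
open import Algebra.Properties.CommutativeSemigroup *-commutativeSemigroup using (x∙yz≈y∙xz)

private variable
  m l : ℕ
  P Q R : Set

-- Binds tighter than _+_ but looser than _*_, unlike the library's syntax for sums.
infixl 6.5 ∑-syntax

∑-syntax : ∀ l → (Fin l → ℕ) → ℕ
∑-syntax _ = sum

syntax ∑-syntax l (λ i → x) = ∑[ i < l ] x

-- Finite sums of natural numbers

∑-mono : {f g : Fin l → ℕ} → (∀ i → f i ≤ g i) → sum f ≤ sum g
∑-mono {zero}  f≤g = z≤n
∑-mono {suc l} f≤g = +-mono-≤ (f≤g zero) (∑-mono (f≤g ∘ suc))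

∑-zero : (f : Fin l → ℕ) → (∀ i → f i ≡ 0) → sum f ≡ 0
∑-zero {zero}  f f≡0 = refl
∑-zero {suc l} f f≡0 = cong₂ _+_ (f≡0 zero) (∑-zero (f ∘ suc) (f≡0 ∘ suc))

∑-single : (i : Fin l) (t : Fin l → ℕ) → (∀ j → i ≢ j → t j ≡ 0) → sum t ≡ t i
∑-single zero    t t≡0 = trans (cong (t zero +_) (∑-zero (t ∘ suc) λ j → t≡0 (suc j) λ ())) (+-identityʳ _)
∑-single (suc i) t t≡0 = cong₂ _+_ (t≡0 zero λ ()) (∑-single i (t ∘ suc) λ j i≢j → t≡0 (suc j) λ { refl → i≢j refl })

term≤∑ : (t : Fin l → ℕ) (i : Fin l) → t i ≤ sum t
term≤∑ t zero    = m≤m+n _ _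
term≤∑ t (suc i) = m≤n⇒m≤o+n _ (term≤∑ (t ∘ suc) i)

∑-↑ : ∀ m (t : Fin (m + l) → ℕ) → sum t ≡ ∑[ i < m ] t (i ↑ˡ l) + ∑[ j < l ] t (m ↑ʳ j)
∑-↑ zero    t = refl
∑-↑ (suc m) t = trans (cong (t zero +_) (∑-↑ m (t ∘ suc))) (sym (+-assoc (t zero) _ _))

∑-combine : ∀ m (t : Fin (m * l) → ℕ) → sum t ≡ ∑[ i < m ] ∑[ j < l ] t (combine i j)
∑-combine         zero    t = refl
∑-combine {l = l} (suc m) t = trans (∑-↑ l t) (cong (sum (λ j → t (j ↑ˡ (m * l))) +_) (∑-combine m (t ∘ (l ↑ʳ_))))

-- Indicators and cardinalities of decidable predicates

⟦_⟧ : Dec P → ℕ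
⟦ yes _ ⟧ = 1
⟦ no _ ⟧  = 0

⟦⟧-yes : (P? : Dec P) → P → ⟦ P? ⟧ ≡ 1
⟦⟧-yes (yes _) p = refl
⟦⟧-yes (no ¬p) p = contradiction p ¬p

⟦⟧-no : (P? : Dec P) → ¬ P → ⟦ P? ⟧ ≡ 0
⟦⟧-no (yes p) ¬p = contradiction p ¬p
⟦⟧-no (no _)  ¬p = refl

⟦⟧-mono : (P? : Dec P) (Q? : Dec Q) → (P → Q) → ⟦ P? ⟧ ≤ ⟦ Q? ⟧
⟦⟧-mono (no _)  Q? p⇒q = z≤n
⟦⟧-mono (yes p) Q? p⇒q = ≤-reflexive (sym (⟦⟧-yes Q? (p⇒q p)))

⟦⟧-cong : (P? : Dec P) (Q? : Dec Q) → (P → Q) → (Q → P) → ⟦ P? ⟧ ≡ ⟦ Q? ⟧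
⟦⟧-cong P? Q? p⇒q q⇒p = ≤-antisym (⟦⟧-mono P? Q? p⇒q) (⟦⟧-mono Q? P? q⇒p)

⟦⟧-cover : (P? : Dec P) (Q? : Dec Q) (R? : Dec R) → (R → P ⊎ Q) → ⟦ R? ⟧ ≤ ⟦ P? ⟧ + ⟦ Q? ⟧
⟦⟧-cover P? Q? (no _)  f = z≤n
⟦⟧-cover P? Q? (yes r) f with f r
... | inj₁ p = ≤-trans (≤-reflexive (sym (⟦⟧-yes P? p))) (m≤m+n _ _)
... | inj₂ q = ≤-trans (≤-reflexive (sym (⟦⟧-yes Q? q))) (m≤n+m _ _)

⟦⟧-disjoint : (P? : Dec P) (Q? : Dec Q) (R? : Dec R) → (P → R) → (Q → R) → (P → ¬ Q) → ⟦ P? ⟧ + ⟦ Q? ⟧ ≤ ⟦ R? ⟧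
⟦⟧-disjoint (no _)  Q?      R? p⇒r q⇒r p⇒¬q = ⟦⟧-mono Q? R? q⇒r
⟦⟧-disjoint (yes p) (yes q) R? p⇒r q⇒r p⇒¬q = contradiction q (p⇒¬q p)
⟦⟧-disjoint (yes p) (no _)  R? p⇒r q⇒r p⇒¬q = ≤-reflexive (sym (⟦⟧-yes R? (p⇒r p)))

⟦⟧-× : (P? : Dec P) (Q? : Dec Q) → ⟦ P? ×-dec Q? ⟧ ≡ ⟦ P? ⟧ * ⟦ Q? ⟧
⟦⟧-× (no _)  Q?      = refl
⟦⟧-× (yes _) (yes _) = refl
⟦⟧-× (yes _) (no _)  = refl

⟦⟧-*-mono : (P? : Dec P) {x y : ℕ} → (P → x ≤ y) → ⟦ P? ⟧ * x ≤ ⟦ P? ⟧ * y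
⟦⟧-*-mono (no _)  f = z≤n
⟦⟧-*-mono (yes p) f = +-monoˡ-≤ 0 (f p)

⟦⟧-*-cong : (P? : Dec P) {x y : ℕ} → (P → x ≡ y) → ⟦ P? ⟧ * x ≡ ⟦ P? ⟧ * y
⟦⟧-*-cong P? f = ≤-antisym (⟦⟧-*-mono P? (≤-reflexive ∘ f)) (⟦⟧-*-mono P? (≤-reflexive ∘ sym ∘ f))

# : {A : Pred (Fin l) 0ℓ} → Decidable A → ℕ
# A? = sum λ i → ⟦ A? i ⟧

module _ {A B : Pred (Fin l) 0ℓ} (A? : Decidable A) (B? : Decidable B) where

  module _ {D : Pred (Fin l) 0ℓ} (D? : Decidable D) where

    #-cover : (∀ i → D i → A i ⊎ B i) → # D? ≤ # A? + # B?
    #-cover f = ≤-trans (∑-mono λ i → ⟦⟧-cover (A? i) (B? i) (D? i) (f i)) (≤-reflexive (∑-distrib-+ (λ i → ⟦ A? i ⟧) (λ i → ⟦ B? i ⟧)))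

    #-disjoint : (∀ i → A i → D i) → (∀ i → B i → D i) → (∀ i → A i → ¬ B i) → # A? + # B? ≤ # D?
    #-disjoint f g h = ≤-trans (≤-reflexive (sym (∑-distrib-+ (λ i → ⟦ A? i ⟧) (λ i → ⟦ B? i ⟧))))
      (∑-mono λ i → ⟦⟧-disjoint (A? i) (B? i) (D? i) (f i) (g i) (h i))

#-× : {A : Pred (Fin m) 0ℓ} {B : Pred (Fin l) 0ℓ} (A? : Decidable A) (B? : Decidable B) →
  ∑[ a < m ] ∑[ b < l ] ⟦ A? a ×-dec B? b ⟧ ≡ # A? * # B?
#-× A? B? = trans
  (sum-cong-≗ λ a → trans (sum-cong-≗ λ b → ⟦⟧-× (A? a) (B? b)) (sym (*-distribˡ-sum ⟦ A? a ⟧ (λ b → ⟦ B? b ⟧))))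
  (sym (*-distribʳ-sum (# B?) (λ a → ⟦ A? a ⟧)))

-- Finite symmetric graphs, their endomorphisms and independent sets

-- The vertices of a strong resolving graph are not renumbered: the relation lives on all of
-- `Fin l`, and `∂`, the vertices that have a neighbour, plays the part of the vertex set. For
-- mutual maximal distance this is the boundary.
record SymGraph (l : ℕ) : Set₁ where
  field
    _∼_     : B.Rel (Fin l) 0ℓ
    _∼?_    : B.Decidable _∼_
    ∼-sym   : B.Symmetric _∼_

  ∂ : Pred (Fin l) 0ℓ
  ∂ u = ∃ λ v → u ∼ v

  ∂? : Decidable ∂
  ∂? u = any? (u ∼?_)

  Cover : Pred (Fin l) 0ℓ → Set
  Cover C = ∀ u v → u ∼ v → C u ⊎ C v

  Independent : Pred (Fin l) 0ℓ → Set
  Independent A = ∀ u v → A u → A v → ¬ (u ∼ v)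

  N[_] : Pred (Fin l) 0ℓ → Pred (Fin l) 0ℓ
  N[ A ] u = A u ⊎ ∃ λ v → u ∼ v × A v

  N[_]? : {A : Pred (Fin l) 0ℓ} → Decidable A → Decidable N[ A ]
  N[ A? ]? u = A? u ⊎-dec any? λ v → (u ∼? v) ×-dec A? v

  Hom : (Fin l → Fin l) → Set
  Hom f = ∀ u v → u ∼ v → f u ∼ f v

  record Automorphism : Set where
    field
      perm  : Permutation′ l
      hom   : Hom (perm ⟨$⟩ʳ_)
      hom⁻¹ : Hom (perm ⟨$⟩ˡ_)

  Transitive : Set
  Transitive = ∀ x y → ∂ x → ∂ y → Σ Automorphism λ τ → Automorphism.perm τ ⟨$⟩ʳ x ≡ y

  record CoverNumber (β : ℕ) : Set₁ where
    field
      C       : Pred (Fin l) 0ℓ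
      C?      : Decidable C
      cover   : Cover C
      size    : # C? ≡ β
      minimal : {D : Pred (Fin l) 0ℓ} (D? : Decidable D) → Cover D → β ≤ # D?

  -- Only subsets of `∂` compete, since every vertex outside `∂` is isolated and could be added to
  -- any independent set.
  record IndependenceNumber (α : ℕ) : Set₁ where
    field
      I       : Pred (Fin l) 0ℓ
      I?      : Decidable I
      I⊆∂     : ∀ u → I u → ∂ u
      indep   : Independent I
      size    : # I? ≡ α
      maximal : {A : Pred (Fin l) 0ℓ} (A? : Decidable A) → (∀ u → A u → ∂ u) → Independent A → # A? ≤ α

funToFin-cong : {f g : Fin m → Fin l} → f ≗ g → funToFin f ≡ funToFin g
funToFin-cong {zero}  f≗g = refl
funToFin-cong {suc m} f≗g = cong₂ combine (f≗g zero) (funToFin-cong (f≗g ∘ suc))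

-- Serves as a change of summation variable in sums over all coded functions.
postCompose : Permutation′ l → Permutation′ (l ^ m)
postCompose {l} {m} π = permutation (post (π ⟨$⟩ʳ_)) (post (π ⟨$⟩ˡ_))
  (undo (π ⟨$⟩ʳ_) (π ⟨$⟩ˡ_) λ _ → inverseʳ π) (undo (π ⟨$⟩ˡ_) (π ⟨$⟩ʳ_) λ _ → inverseˡ π)
  where
  post : (Fin l → Fin l) → Fin (l ^ m) → Fin (l ^ m)
  post f k = funToFin (f ∘ finToFun {l} {m} k)
  undo : (f g : Fin l → Fin l) → f ∘ g ≗ id → post f ∘ post g ≗ id
  undo f g f∘g≗id k = trans
    (funToFin-cong λ i → trans (cong f (finToFun-funToFin (g ∘ finToFun {l} {m} k) i)) (f∘g≗id (finToFun {l} {m} k i)))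
    (funToFin-finToFin {m} {l} k)

-- The no-homomorphism argument. Endomorphisms are enumerated as the elements of Fin (l ^ l);
-- composing with automorphisms shows that a vertex x of ∂ is sent to each y in ∂ by the same
-- number of them. Averaging the size of the pullback of a maximum independent set to ∂ ∖ N[A],
-- which together with A is again independent, gives the ratio bound.

module Averaging (G : SymGraph l) (transitive : SymGraph.Transitive G) where
  open SymGraph G

  app : Fin (l ^ l) → Fin l → Fin l
  app = finToFun

  Endo? : Decidable (Hom ∘ app)
  Endo? k = all? λ u → all? λ v → (u ∼? v) →-dec (app k u ∼? app k v)

  endos : ℕ
  endos = ∑[ k < l ^ l ] ⟦ Endo? k ⟧

  -- The identity is an endomorphism. This allows `endos` to be cancelled at the end of the
  -- averaging.
  endos≥1 : 1 ≤ endos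
  endos≥1 = ≤-trans (≤-reflexive (sym (⟦⟧-yes (Endo? identity) identity-hom))) (term≤∑ (λ k → ⟦ Endo? k ⟧) identity)
    where
    identity : Fin (l ^ l)
    identity = funToFin {l} {l} id
    identity-hom : Hom (app identity)
    identity-hom u v u∼v rewrite finToFun-funToFin {l} {l} id u | finToFun-funToFin {l} {l} id v = u∼v

  hits : {B : Pred (Fin l) 0ℓ} → Decidable B → Fin l → ℕ
  hits B? x = ∑[ k < l ^ l ] ⟦ Endo? k ⟧ * ⟦ B? (app k x) ⟧

  -- Composing with `τ` permutes the coded functions, preserves and reflects being an endomorphism
  -- (the latter by `hom⁻¹`), and turns the value `y` at `x` into `τ y`.
  hits-invariant : (τ : Automorphism) (x y : Fin l) →
    hits (_≟ y) x ≡ hits (_≟ (Automorphism.perm τ ⟨$⟩ʳ y)) x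
  hits-invariant τ x y = sym (trans (sum-permute (λ k → ⟦ Endo? k ⟧ * ⟦ app k x ≟ (perm ⟨$⟩ʳ y) ⟧) (postCompose {m = l} perm))
    (sum-cong-≗ λ k → cong₂ _*_
      (⟦⟧-cong (Endo? _) (Endo? k) (before k) (after k))
      (⟦⟧-cong (_ ≟ _) (_ ≟ _)
        (λ e → trans (sym (inverseˡ perm)) (trans (cong (perm ⟨$⟩ˡ_) (trans (sym (post k x)) e)) (inverseˡ perm)))
        (λ e → trans (post k x) (cong (perm ⟨$⟩ʳ_) e)))))
    where
    open Automorphism τ
    post : ∀ k u → app (postCompose {m = l} perm ⟨$⟩ʳ k) u ≡ perm ⟨$⟩ʳ app k u
    post k = finToFun-funToFin {l} {l} ((perm ⟨$⟩ʳ_) ∘ app k)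
    after : ∀ k → Hom (app k) → Hom (app (postCompose {m = l} perm ⟨$⟩ʳ k))
    after k h u v u∼v rewrite post k u | post k v = hom _ _ (h u v u∼v)
    before : ∀ k → Hom (app (postCompose {m = l} perm ⟨$⟩ʳ k)) → Hom (app k)
    before k h u v u∼v with h u v u∼v
    ... | e rewrite post k u | post k v with hom⁻¹ _ _ e
    ... | e′ rewrite inverseˡ perm {app k u} | inverseˡ perm {app k v} = e′

  module _ {B : Pred (Fin l) 0ℓ} (B? : Decidable B) where

    -- Endomorphisms are sorted by their value at `x`: for each `k`, only the term `y = app k x` of
    -- the inner sum survives.
    hits-fibres : ∀ x → hits B? x ≡ ∑[ y < l ] ⟦ B? y ⟧ * hits (_≟ y) x
    hits-fibres x = begin
      ∑[ k < l ^ l ] ⟦ Endo? k ⟧ * ⟦ B? (app k x) ⟧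
        ≡⟨ sum-cong-≗ fibre ⟩
      ∑[ k < l ^ l ] ∑[ y < l ] ⟦ B? y ⟧ * (⟦ Endo? k ⟧ * ⟦ app k x ≟ y ⟧)
        ≡⟨ ∑-comm (λ k y → ⟦ B? y ⟧ * (⟦ Endo? k ⟧ * ⟦ app k x ≟ y ⟧)) ⟩
      ∑[ y < l ] ∑[ k < l ^ l ] ⟦ B? y ⟧ * (⟦ Endo? k ⟧ * ⟦ app k x ≟ y ⟧)
        ≡⟨ sum-cong-≗ (λ y → sym (*-distribˡ-sum ⟦ B? y ⟧ (λ k → ⟦ Endo? k ⟧ * ⟦ app k x ≟ y ⟧))) ⟩
      ∑[ y < l ] ⟦ B? y ⟧ * hits (_≟ y) x ∎
      where
      open ≡-Reasoning
      fibre : ∀ k → ⟦ Endo? k ⟧ * ⟦ B? (app k x) ⟧ ≡ ∑[ y < l ] ⟦ B? y ⟧ * (⟦ Endo? k ⟧ * ⟦ app k x ≟ y ⟧)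
      fibre k = sym (trans
        (∑-single (app k x) (λ y → ⟦ B? y ⟧ * (⟦ Endo? k ⟧ * ⟦ app k x ≟ y ⟧))
          λ y x≢y → trans (cong (λ z → ⟦ B? y ⟧ * (⟦ Endo? k ⟧ * z)) (⟦⟧-no (_ ≟ y) x≢y))
                    (trans (cong (⟦ B? y ⟧ *_) (*-zeroʳ ⟦ Endo? k ⟧)) (*-zeroʳ ⟦ B? y ⟧)))
        (trans (cong (λ z → ⟦ B? (app k x) ⟧ * (⟦ Endo? k ⟧ * z)) (⟦⟧-yes (app k x ≟ app k x) refl))
        (trans (cong (⟦ B? (app k x) ⟧ *_) (*-identityʳ ⟦ Endo? k ⟧)) (*-comm ⟦ B? (app k x) ⟧ _))))

    -- By transitivity the fibres over all `y` in `∂` have the size of the fibre over `x` itself.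
    hits-uniform : (∀ u → B u → ∂ u) → ∀ x → ∂ x → hits B? x ≡ # B? * hits (_≟ x) x
    hits-uniform B⊆∂ x x∈∂ = trans (hits-fibres x) (trans
      (sum-cong-≗ λ y → ⟦⟧-*-cong (B? y) λ By → constant y (B⊆∂ y By))
      (sym (*-distribʳ-sum (hits (_≟ x) x) (λ y → ⟦ B? y ⟧))))
      where
      constant : ∀ y → ∂ y → hits (_≟ y) x ≡ hits (_≟ x) x
      constant y y∈∂ with transitive x y x∈∂ y∈∂
      ... | τ , refl = sym (hits-invariant τ x x)

  -- The common fibre size `c` is found by taking `∂` for `B`: an endomorphism carries a neighbour
  -- of `x` to a neighbour of its image, so every endomorphism keeps `x` in `∂` and `# ∂? * c`
  -- equals `endos`.
  hits-proportion : {B : Pred (Fin l) 0ℓ} (B? : Decidable B) → (∀ u → B u → ∂ u) →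
    ∀ x → ∂ x → # ∂? * hits B? x ≡ # B? * endos
  hits-proportion B? B⊆∂ x x∈∂ = begin
    # ∂? * hits B? x   ≡⟨ cong (# ∂? *_) (hits-uniform B? B⊆∂ x x∈∂) ⟩
    # ∂? * (# B? * c)  ≡⟨ x∙yz≈y∙xz (# ∂?) (# B?) c ⟩
    # B? * (# ∂? * c)  ≡⟨ cong (# B? *_) (trans (sym (hits-uniform ∂? (λ _ → id) x x∈∂)) (sym endos-hit-∂)) ⟩
    # B? * endos       ∎
    where
    open ≡-Reasoning
    c : ℕ
    c = hits (_≟ x) x
    endos-hit-∂ : endos ≡ hits ∂? x
    endos-hit-∂ = sum-cong-≗ λ k → trans (sym (*-identityʳ ⟦ Endo? k ⟧))
      (⟦⟧-*-cong (Endo? k) λ h → sym (⟦⟧-yes (∂? (app k x)) (_ , h _ _ (proj₂ x∈∂))))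

  module _ {α : ℕ} (independenceNumber : IndependenceNumber α) where
    open IndependenceNumber independenceNumber

    independent-ratio : {A : Pred (Fin l) 0ℓ} (A? : Decidable A) → (∀ u → A u → ∂ u) → Independent A →
      # ∂? * # A? ≤ α * # N[ A? ]?
    independent-ratio {A} A? A⊆∂ A-indep =
      -- The claim is padded by `α * # W?` and multiplied by `endos`. The padding becomes the total
      -- size of the pullbacks of `I` to `W`, because each `x` in `W` is hit in the proportion `α`
      -- to `p`.
      +-cancelʳ-≤ (α * # W?) _ _ (*-cancelʳ-≤ _ _ endos {{>-nonZero endos≥1}} (begin
        (p * # A? + α * # W?) * endos
          ≡⟨ rearrange p (# A?) α (# W?) endos ⟩
        p * (endos * # A?) + # W? * (α * endos)
          ≡⟨ cong (p * (endos * # A?) +_) (sym weighted-hits) ⟩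
        p * (endos * # A?) + p * (∑[ x < l ] ⟦ W? x ⟧ * hits I? x)
          ≡⟨ sym (*-distribˡ-+ p _ _) ⟩
        p * (endos * # A? + ∑[ x < l ] ⟦ W? x ⟧ * hits I? x)
          ≤⟨ *-monoʳ-≤ p averaged ⟩
        p * (endos * α)
          ≤⟨ *-monoˡ-≤ (endos * α) (#-cover N[ A? ]? W? ∂? split) ⟩
        (# N[ A? ]? + # W?) * (endos * α)
          ≡⟨ rearrange′ (# N[ A? ]?) (# W?) endos α ⟩
        (α * # N[ A? ]? + α * # W?) * endos ∎))
      where
      open ≤-Reasoning
      p : ℕ
      p = # ∂?
      W : Pred (Fin l) 0ℓ
      W u = ∂ u × ¬ N[ A ] u
      W? : Decidable W
      W? u = ∂? u ×-dec ¬? (N[ A? ]? u)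
      split : ∀ u → ∂ u → N[ A ] u ⊎ W u
      split u u∈∂ with N[ A? ]? u
      ... | yes q = inj₁ q
      ... | no ¬q = inj₂ (u∈∂ , ¬q)
      pullback : Fin (l ^ l) → Pred (Fin l) 0ℓ
      pullback k u = W u × I (app k u)
      pullback? : ∀ k → Decidable (pullback k)
      pullback? k u = W? u ×-dec I? (app k u)
      joined? : ∀ k → Decidable (λ u → A u ⊎ pullback k u)
      joined? k u = A? u ⊎-dec pullback? k u
      -- No edge joins `A` to `W`, as `W` avoids `N[ A ]`; an edge inside the pullback would be
      -- mapped to an edge inside `I`.
      joined-indep : ∀ k → Hom (app k) → Independent (λ u → A u ⊎ pullback k u)
      joined-indep k h u v (inj₁ a) (inj₁ b) u∼v = A-indep u v a b u∼v
      joined-indep k h u v (inj₁ a) (inj₂ ((_ , ∉N) , _)) u∼v = ∉N (inj₂ (u , ∼-sym u∼v , a))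
      joined-indep k h u v (inj₂ ((_ , ∉N) , _)) (inj₁ b) u∼v = ∉N (inj₂ (v , u∼v , b))
      joined-indep k h u v (inj₂ (_ , i)) (inj₂ (_ , j)) u∼v = indep _ _ i j (h u v u∼v)
      bound : ∀ k → Hom (app k) → # A? + # (pullback? k) ≤ α
      bound k h = ≤-trans
        (#-disjoint A? (pullback? k) (joined? k) (λ _ → inj₁) (λ _ → inj₂) (λ u a ((_ , ∉N) , _) → ∉N (inj₁ a)))
        (maximal (joined? k) (λ { u (inj₁ a) → A⊆∂ u a ; u (inj₂ ((u∈∂ , _) , _)) → u∈∂ }) (joined-indep k h))
      averaged : endos * # A? + ∑[ x < l ] ⟦ W? x ⟧ * hits I? x ≤ endos * α
      averaged = begin
        endos * # A? + ∑[ x < l ] ⟦ W? x ⟧ * hits I? x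
          ≡⟨ cong₂ _+_ (*-distribʳ-sum (# A?) (λ k → ⟦ Endo? k ⟧)) swap-sums ⟩
        ∑[ k < l ^ l ] ⟦ Endo? k ⟧ * # A? + ∑[ k < l ^ l ] ⟦ Endo? k ⟧ * # (pullback? k)
          ≡⟨ sym (∑-distrib-+ (λ k → ⟦ Endo? k ⟧ * # A?) (λ k → ⟦ Endo? k ⟧ * # (pullback? k))) ⟩
        ∑[ k < l ^ l ] (⟦ Endo? k ⟧ * # A? + ⟦ Endo? k ⟧ * # (pullback? k))
          ≡⟨ sum-cong-≗ (λ k → sym (*-distribˡ-+ ⟦ Endo? k ⟧ (# A?) (# (pullback? k)))) ⟩
        ∑[ k < l ^ l ] ⟦ Endo? k ⟧ * (# A? + # (pullback? k))
          ≤⟨ ∑-mono (λ k → ⟦⟧-*-mono (Endo? k) (bound k)) ⟩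
        ∑[ k < l ^ l ] ⟦ Endo? k ⟧ * α
          ≡⟨ sym (*-distribʳ-sum α (λ k → ⟦ Endo? k ⟧)) ⟩
        endos * α ∎
        where
        -- Double counting of the pairs of a vertex `x` in `W` and an endomorphism that sends `x`
        -- into `I`.
        swap-sums : ∑[ x < l ] ⟦ W? x ⟧ * hits I? x ≡ ∑[ k < l ^ l ] ⟦ Endo? k ⟧ * # (pullback? k)
        swap-sums = trans
          (sum-cong-≗ λ x → *-distribˡ-sum ⟦ W? x ⟧ (λ k → ⟦ Endo? k ⟧ * ⟦ I? (app k x) ⟧))
          (trans (∑-comm λ x k → ⟦ W? x ⟧ * (⟦ Endo? k ⟧ * ⟦ I? (app k x) ⟧))
          (sum-cong-≗ λ k → trans
            (sum-cong-≗ λ x → trans (x∙yz≈y∙xz ⟦ W? x ⟧ ⟦ Endo? k ⟧ _)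
              (cong (⟦ Endo? k ⟧ *_) (sym (⟦⟧-× (W? x) (I? (app k x))))))
            (sym (*-distribˡ-sum ⟦ Endo? k ⟧ (λ x → ⟦ pullback? k x ⟧)))))
      weighted-hits : p * (∑[ x < l ] ⟦ W? x ⟧ * hits I? x) ≡ # W? * (α * endos)
      weighted-hits = trans (*-distribˡ-sum p (λ x → ⟦ W? x ⟧ * hits I? x)) (trans
        (sum-cong-≗ λ x → trans (x∙yz≈y∙xz p ⟦ W? x ⟧ _) (⟦⟧-*-cong (W? x) λ (x∈∂ , _) →
          trans (hits-proportion I? I⊆∂ x x∈∂) (cong (_* endos) size)))
        (sym (*-distribʳ-sum (α * endos) (λ x → ⟦ W? x ⟧))))
      rearrange : ∀ p a α w e → (p * a + α * w) * e ≡ p * (e * a) + w * (α * e)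
      rearrange = solve-∀
      rearrange′ : ∀ ν w e α → (ν + w) * (e * α) ≡ (α * ν + α * w) * e
      rearrange′ = solve-∀

-- Vertex covers and independent sets

module _ (G : SymGraph l) where
  open SymGraph G

  module _ {β : ℕ} (coverNumber : CoverNumber β) where
    open CoverNumber coverNumber

    -- Gallai's identity: complements within `∂` exchange covers and independent sets.
    independenceNumber : Σ ℕ λ α → IndependenceNumber α × # ∂? ≡ α + β
    independenceNumber = # I? , record
      { I? = I? ; I⊆∂ = λ _ → proj₁ ; indep = I-indep ; size = refl ; maximal = maximal } ,
      ≤-antisym
        (≤-trans (#-cover I? C? ∂? I∪C) (+-monoʳ-≤ (# I?) (≤-reflexive size)))
        -- `C` is not assumed to lie in `∂`. Its trace on `∂` still covers every edge, so it has at
        -- least `β` elements and is disjoint from `I`.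
        (≤-trans (+-monoʳ-≤ (# I?) (minimal C∩∂? C∩∂-cover))
          (#-disjoint I? C∩∂? ∂? (λ _ → proj₁) (λ _ → proj₂) λ _ (_ , ∉C) (∈C , _) → ∉C ∈C))
      where
      I : Pred (Fin l) 0ℓ
      I u = ∂ u × ¬ C u
      I? : Decidable I
      I? u = ∂? u ×-dec ¬? (C? u)
      C∩∂? : Decidable (λ u → C u × ∂ u)
      C∩∂? u = C? u ×-dec ∂? u
      I∪C : ∀ u → ∂ u → I u ⊎ C u
      I∪C u u∈∂ with C? u
      ... | yes ∈C = inj₂ ∈C
      ... | no ∉C  = inj₁ (u∈∂ , ∉C)
      C∩∂-cover : Cover (λ u → C u × ∂ u)
      C∩∂-cover u v u∼v with cover u v u∼v
      ... | inj₁ ∈C = inj₁ (∈C , v , u∼v)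
      ... | inj₂ ∈C = inj₂ (∈C , u , ∼-sym u∼v)
      I-indep : Independent I
      I-indep u v (_ , u∉C) (_ , v∉C) u∼v with cover u v u∼v
      ... | inj₁ u∈C = u∉C u∈C
      ... | inj₂ v∈C = v∉C v∈C
      maximal : {A : Pred (Fin l) 0ℓ} (A? : Decidable A) → (∀ u → A u → ∂ u) → Independent A → # A? ≤ # I?
      maximal {A} A? A⊆∂ A-indep = +-cancelʳ-≤ β _ _ (begin
        # A? + β      ≤⟨ +-monoʳ-≤ (# A?) (minimal A′? A′-cover) ⟩
        # A? + # A′?  ≤⟨ #-disjoint A? A′? ∂? A⊆∂ (λ _ → proj₁) (λ _ a (_ , ¬a) → ¬a a) ⟩
        # ∂?          ≤⟨ #-cover I? C? ∂? I∪C ⟩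
        # I? + # C?   ≡⟨ cong (# I? +_) size ⟩
        # I? + β      ∎)
        where
        open ≤-Reasoning
        A′ : Pred (Fin l) 0ℓ
        A′ u = ∂ u × ¬ A u
        A′? : Decidable A′
        A′? u = ∂? u ×-dec ¬? (A? u)
        A′-cover : Cover A′
        A′-cover u v u∼v with A? u | A? v
        ... | no ¬a | _     = inj₁ ((v , u∼v) , ¬a)
        ... | yes _ | no ¬b = inj₂ ((u , ∼-sym u∼v) , ¬b)
        ... | yes a | yes b = contradiction u∼v (A-indep u v a b)

-- Direct products

module _ (G : SymGraph m) (H : SymGraph l)
  (transᴳ : SymGraph.Transitive G) (transᴴ : SymGraph.Transitive H)
  {βᴳ βᴴ : ℕ} (coverᴳ : SymGraph.CoverNumber G βᴳ) (coverᴴ : SymGraph.CoverNumber H βᴴ)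
  {C : Fin m → Fin l → Set} (C? : B.Decidable C)
  (cover : ∀ {a a′ b b′} → SymGraph._∼_ G a a′ → SymGraph._∼_ H b b′ → C a b ⊎ C a′ b′)
  where

  open SymGraph G using () renaming (_∼_ to _∼ᴳ_; ∂ to ∂ᴳ; ∂? to ∂ᴳ?; ∼-sym to ∼ᴳ-sym)
  open SymGraph H using () renaming (_∼_ to _∼ᴴ_; ∂ to ∂ᴴ; ∂? to ∂ᴴ?; ∼-sym to ∼ᴴ-sym; _∼?_ to _∼ᴴ?_)

  private
    -- `M` is the value of Zhang's formula for the independence number of the direct product;
    -- `S-bound` establishes it as an upper bound.
    p q αᴳ αᴴ M : ℕ
    p  = # ∂ᴳ?
    q  = # ∂ᴴ?
    αᴳ = proj₁ (independenceNumber G coverᴳ)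
    αᴴ = proj₁ (independenceNumber H coverᴴ)
    M  = p * αᴴ ⊔ q * αᴳ

    α-numberᴳ : SymGraph.IndependenceNumber G αᴳ
    α-numberᴳ = proj₁ (proj₂ (independenceNumber G coverᴳ))

    α-numberᴴ : SymGraph.IndependenceNumber H αᴴ
    α-numberᴴ = proj₁ (proj₂ (independenceNumber H coverᴴ))

    β+α≡p : βᴳ + αᴳ ≡ p
    β+α≡p = trans (+-comm βᴳ αᴳ) (sym (proj₂ (proj₂ (independenceNumber G coverᴳ))))

    β+α≡q : βᴴ + αᴴ ≡ q
    β+α≡q = trans (+-comm βᴴ αᴴ) (sym (proj₂ (proj₂ (independenceNumber H coverᴴ))))

    S I K : Fin m → Fin l → Set
    S a b = ∂ᴳ a × ∂ᴴ b × ¬ C a b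
    I a b = S a b × ¬ ∃ λ b′ → b ∼ᴴ b′ × S a b′
    K a b = S a b × ∃ λ b′ → b ∼ᴴ b′ × S a b′

    S? : B.Decidable S
    S? a b = ∂ᴳ? a ×-dec ∂ᴴ? b ×-dec ¬? (C? a b)
    nbr? : ∀ a b → Dec (∃ λ b′ → b ∼ᴴ b′ × S a b′)
    nbr? a b = any? λ b′ → (b ∼ᴴ? b′) ×-dec S? a b′
    I? : B.Decidable I
    I? a b = S? a b ×-dec ¬? (nbr? a b)
    K? : B.Decidable K
    K? a b = S? a b ×-dec nbr? a b

    S-indep : ∀ {a a′ b b′} → a ∼ᴳ a′ → b ∼ᴴ b′ → S a b → ¬ S a′ b′
    S-indep a∼a′ b∼b′ (_ , _ , ∉C) (_ , _ , ∉C′) with cover a∼a′ b∼b′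
    ... | inj₁ ∈C  = ∉C ∈C
    ... | inj₂ ∈C′ = ∉C′ ∈C′

    NI? : B.Decidable (λ a b → SymGraph.N[_] H (I a) b)
    NI? a = SymGraph.N[_]? H (I? a)
    NK? : B.Decidable (λ a b → SymGraph.N[_] G (λ a′ → K a′ b) a)
    NK? a b = SymGraph.N[_]? G (λ a′ → K? a′ b) a

    -- A common point `(a , b)` either gives a point of `I` a neighbour in its row, or yields two
    -- points of `S` that are adjacent in the product. If `(a , b)` is in `I` and `(a′ , b)` in `K`,
    -- the second of these points is the row neighbour `(a′ , b′)` that membership in `K` provides.
    NI-NK-disjoint : ∀ a b → SymGraph.N[_] H (I a) b → ¬ SymGraph.N[_] G (λ a′ → K a′ b) a
    NI-NK-disjoint a b (inj₁ (_ , isolated)) (inj₁ (_ , nbr)) = isolated nbr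
    NI-NK-disjoint a b (inj₁ (s , _)) (inj₂ (a′ , a∼a′ , _ , b′ , b∼b′ , s′)) = S-indep a∼a′ b∼b′ s s′
    NI-NK-disjoint a b (inj₂ (b′ , b∼b′ , _ , isolated)) (inj₁ (s , _)) = isolated (b , ∼ᴴ-sym b∼b′ , s)
    NI-NK-disjoint a b (inj₂ (b′ , b∼b′ , s , _)) (inj₂ (a′ , a∼a′ , s′ , _)) = S-indep a∼a′ (∼ᴴ-sym b∼b′) s s′

    ∑∑ : (Fin m → Fin l → ℕ) → ℕ
    ∑∑ f = ∑[ a < m ] ∑[ b < l ] f a b

    ∑∑-mono : {f g : Fin m → Fin l → ℕ} → (∀ a b → f a b ≤ g a b) → ∑∑ f ≤ ∑∑ g
    ∑∑-mono f≤g = ∑-mono λ a → ∑-mono (f≤g a)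

    ∑∑-+ : ∀ f g → ∑∑ (λ a b → f a b + g a b) ≡ ∑∑ f + ∑∑ g
    ∑∑-+ f g = trans (sum-cong-≗ λ a → ∑-distrib-+ (f a) (g a)) (∑-distrib-+ (λ a → sum (f a)) (λ a → sum (g a)))

    ∑∑-∂ : ∑∑ (λ a b → ⟦ ∂ᴳ? a ×-dec ∂ᴴ? b ⟧) ≡ p * q
    ∑∑-∂ = #-× ∂ᴳ? ∂ᴴ?

    -- Each row of `I` is independent in `H`, so the ratio bound of `H` applies row by row.
    I-bound : p * q * ∑∑ (λ a b → ⟦ I? a b ⟧) ≤ M * ∑∑ (λ a b → ⟦ NI? a b ⟧)
    I-bound = begin
      p * q * ∑∑ (λ a b → ⟦ I? a b ⟧)  ≡⟨ *-distribˡ-sum (p * q) (λ a → # (I? a)) ⟩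
      ∑[ a < m ] p * q * # (I? a)      ≤⟨ ∑-mono row ⟩
      ∑[ a < m ] M * # (NI? a)         ≡⟨ sym (*-distribˡ-sum M (λ a → # (NI? a))) ⟩
      M * ∑∑ (λ a b → ⟦ NI? a b ⟧)     ∎
      where
      open ≤-Reasoning
      row : ∀ a → p * q * # (I? a) ≤ M * # (NI? a)
      row a = begin
        p * q * # (I? a)        ≡⟨ *-assoc p q _ ⟩
        p * (q * # (I? a))      ≤⟨ *-monoʳ-≤ p (Averaging.independent-ratio H transᴴ α-numberᴴ (I? a)
                                     (λ b ((_ , b∈∂ , _) , _) → b∈∂)
                                     (λ b b′ (_ , isolated) (s , _) b∼b′ → isolated (b′ , b∼b′ , s))) ⟩
        p * (αᴴ * # (NI? a))    ≡⟨ sym (*-assoc p αᴴ _) ⟩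
        p * αᴴ * # (NI? a)      ≤⟨ *-monoˡ-≤ _ (m≤m⊔n (p * αᴴ) (q * αᴳ)) ⟩
        M * # (NI? a)           ∎

    -- Each column of `K` is independent in `G`: if `(a , b)` and `(a′ , b)` in `K` had `a` adjacent
    -- to `a′`, then `(a , b)` would be adjacent in the product to a row neighbour of `(a′ , b)` in
    -- `S`. The ratio bound of `G` then applies column by column.
    K-bound : p * q * ∑∑ (λ a b → ⟦ K? a b ⟧) ≤ M * ∑∑ (λ a b → ⟦ NK? a b ⟧)
    K-bound = begin
      p * q * ∑∑ (λ a b → ⟦ K? a b ⟧)           ≡⟨ cong (p * q *_) (∑-comm λ a b → ⟦ K? a b ⟧) ⟩
      p * q * (∑[ b < l ] # (λ a → K? a b))     ≡⟨ *-distribˡ-sum (p * q) (λ b → # (λ a → K? a b)) ⟩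
      ∑[ b < l ] p * q * # (λ a → K? a b)       ≤⟨ ∑-mono column ⟩
      ∑[ b < l ] M * # (λ a → NK? a b)          ≡⟨ sym (*-distribˡ-sum M (λ b → # (λ a → NK? a b))) ⟩
      M * (∑[ b < l ] # (λ a → NK? a b))        ≡⟨ cong (M *_) (∑-comm λ b a → ⟦ NK? a b ⟧) ⟩
      M * ∑∑ (λ a b → ⟦ NK? a b ⟧)              ∎
      where
      open ≤-Reasoning
      column : ∀ b → p * q * # (λ a → K? a b) ≤ M * # (λ a → NK? a b)
      column b = begin
        p * q * # (λ a → K? a b)        ≡⟨ cong (_* # (λ a → K? a b)) (*-comm p q) ⟩
        q * p * # (λ a → K? a b)        ≡⟨ *-assoc q p _ ⟩
        q * (p * # (λ a → K? a b))      ≤⟨ *-monoʳ-≤ q (Averaging.independent-ratio G transᴳ α-numberᴳ (λ a → K? a b)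
                                             (λ a ((a∈∂ , _) , _) → a∈∂)
                                             (λ a a′ (s , _) (_ , b′ , b∼b′ , s′) a∼a′ → S-indep a∼a′ b∼b′ s s′)) ⟩
        q * (αᴳ * # (λ a → NK? a b))    ≡⟨ sym (*-assoc q αᴳ _) ⟩
        q * αᴳ * # (λ a → NK? a b)      ≤⟨ *-monoˡ-≤ _ (m≤n⊔m (p * αᴴ) (q * αᴳ)) ⟩
        M * # (λ a → NK? a b)           ∎

    -- The two bounds are added; the closed neighbourhoods are disjoint subsets of the product of
    -- the boundaries, hence of total size at most `p * q`. The common factor stays because it may
    -- be zero.
    S-bound : p * q * ∑∑ (λ a b → ⟦ S? a b ⟧) ≤ p * q * M
    S-bound = begin
      p * q * ∑∑ (λ a b → ⟦ S? a b ⟧)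
        ≤⟨ *-monoʳ-≤ (p * q) (∑∑-mono λ a b → ⟦⟧-cover (I? a b) (K? a b) (S? a b) (split a b)) ⟩
      p * q * ∑∑ (λ a b → ⟦ I? a b ⟧ + ⟦ K? a b ⟧)
        ≡⟨ cong (p * q *_) (∑∑-+ _ _) ⟩
      p * q * (∑∑ (λ a b → ⟦ I? a b ⟧) + ∑∑ (λ a b → ⟦ K? a b ⟧))
        ≡⟨ *-distribˡ-+ (p * q) _ _ ⟩
      p * q * ∑∑ (λ a b → ⟦ I? a b ⟧) + p * q * ∑∑ (λ a b → ⟦ K? a b ⟧)
        ≤⟨ +-mono-≤ I-bound K-bound ⟩
      M * ∑∑ (λ a b → ⟦ NI? a b ⟧) + M * ∑∑ (λ a b → ⟦ NK? a b ⟧)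
        ≡⟨ sym (*-distribˡ-+ M _ _) ⟩
      M * (∑∑ (λ a b → ⟦ NI? a b ⟧) + ∑∑ (λ a b → ⟦ NK? a b ⟧))
        ≡⟨ cong (M *_) (sym (∑∑-+ _ _)) ⟩
      M * ∑∑ (λ a b → ⟦ NI? a b ⟧ + ⟦ NK? a b ⟧)
        ≤⟨ *-monoʳ-≤ M (∑∑-mono λ a b → ⟦⟧-disjoint (NI? a b) (NK? a b) (∂ᴳ? a ×-dec ∂ᴴ? b)
             (NI⊆∂ a b) (NK⊆∂ a b) (NI-NK-disjoint a b)) ⟩
      M * ∑∑ (λ a b → ⟦ ∂ᴳ? a ×-dec ∂ᴴ? b ⟧)
        ≡⟨ cong (M *_) ∑∑-∂ ⟩
      M * (p * q)
        ≡⟨ *-comm M (p * q) ⟩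
      p * q * M ∎
      where
      open ≤-Reasoning
      split : ∀ a b → S a b → I a b ⊎ K a b
      split a b s with nbr? a b
      ... | yes nbr     = inj₂ (s , nbr)
      ... | no isolated = inj₁ (s , isolated)
      NI⊆∂ : ∀ a b → SymGraph.N[_] H (I a) b → ∂ᴳ a × ∂ᴴ b
      NI⊆∂ a b (inj₁ ((a∈∂ , b∈∂ , _) , _)) = a∈∂ , b∈∂
      NI⊆∂ a b (inj₂ (b′ , b∼b′ , (a∈∂ , _) , _)) = a∈∂ , b′ , b∼b′
      NK⊆∂ : ∀ a b → SymGraph.N[_] G (λ a′ → K a′ b) a → ∂ᴳ a × ∂ᴴ b
      NK⊆∂ a b (inj₁ ((a∈∂ , b∈∂ , _) , _)) = a∈∂ , b∈∂
      NK⊆∂ a b (inj₂ (a′ , a∼a′ , (_ , b∈∂ , _) , _)) = (a′ , a∼a′) , b∈∂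

    -- Both `p * βᴴ + p * αᴴ` and `q * βᴳ + q * αᴳ` equal `p * q`, so the minimum is bounded by the
    -- term that belongs to the one attaining the maximum `M`.
    min+M≤pq : (p * βᴴ) ⊓ (q * βᴳ) + M ≤ p * q
    min+M≤pq with ⊔-sel (p * αᴴ) (q * αᴳ)
    ... | inj₁ M≡ = begin
      (p * βᴴ) ⊓ (q * βᴳ) + M   ≤⟨ +-mono-≤ (m⊓n≤m _ _) (≤-reflexive M≡) ⟩
      p * βᴴ + p * αᴴ         ≡⟨ sym (*-distribˡ-+ p βᴴ αᴴ) ⟩
      p * (βᴴ + αᴴ)           ≡⟨ cong (p *_) β+α≡q ⟩
      p * q                   ∎
      where open ≤-Reasoning
    ... | inj₂ M≡ = begin
      (p * βᴴ) ⊓ (q * βᴳ) + M   ≤⟨ +-mono-≤ (m⊓n≤n _ _) (≤-reflexive M≡) ⟩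
      q * βᴳ + q * αᴳ         ≡⟨ sym (*-distribˡ-+ q βᴳ αᴳ) ⟩
      q * (βᴳ + αᴳ)           ≡⟨ cong (q *_) β+α≡p ⟩
      q * p                   ≡⟨ *-comm q p ⟩
      p * q                   ∎
      where open ≤-Reasoning

    pq≤S+C : p * q ≤ ∑∑ (λ a b → ⟦ S? a b ⟧) + ∑∑ (λ a b → ⟦ C? a b ⟧)
    pq≤S+C = begin
      p * q                                              ≡⟨ sym ∑∑-∂ ⟩
      ∑∑ (λ a b → ⟦ ∂ᴳ? a ×-dec ∂ᴴ? b ⟧)                 ≤⟨ ∑∑-mono (λ a b → ⟦⟧-cover (S? a b) (C? a b) (∂ᴳ? a ×-dec ∂ᴴ? b) (split a b)) ⟩
      ∑∑ (λ a b → ⟦ S? a b ⟧ + ⟦ C? a b ⟧)               ≡⟨ ∑∑-+ _ _ ⟩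
      ∑∑ (λ a b → ⟦ S? a b ⟧) + ∑∑ (λ a b → ⟦ C? a b ⟧)  ∎
      where
      open ≤-Reasoning
      split : ∀ a b → ∂ᴳ a × ∂ᴴ b → S a b ⊎ C a b
      split a b (a∈∂ , b∈∂) with C? a b
      ... | yes ∈C = inj₂ ∈C
      ... | no ∉C  = inj₁ (a∈∂ , b∈∂ , ∉C)

  product-cover-bound : (p * βᴴ) ⊓ (q * βᴳ) ≤ ∑[ a < m ] ∑[ b < l ] ⟦ C? a b ⟧
  product-cover-bound with p * q in pq≡
  -- Here `p * q` cannot be cancelled from `S-bound`, but `min+M≤pq` already forces the minimum to
  -- be 0.
  ... | zero  = ≤-trans (m≤m+n _ M) (≤-trans min+M≤pq (≤-trans (≤-reflexive pq≡) z≤n))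
  ... | suc r = +-cancelʳ-≤ M _ _ (begin
    (p * βᴴ) ⊓ (q * βᴳ) + M              ≤⟨ min+M≤pq ⟩
    p * q                              ≤⟨ pq≤S+C ⟩
    ∑∑ (λ a b → ⟦ S? a b ⟧) + #C       ≤⟨ +-monoˡ-≤ #C (*-cancelˡ-≤ (p * q) {{subst NonZero (sym pq≡) _}} S-bound) ⟩
    M + #C                             ≡⟨ +-comm M #C ⟩
    #C + M                             ∎)
    where
    open ≤-Reasoning
    #C : ℕ
    #C = ∑∑ (λ a b → ⟦ C? a b ⟧)

-- Boolean quantifiers, subsets and filtered lists

any-true⁺ : (p : Fin l → Bool) {i : Fin l} → p i ≡ true → any p (allFin l) ≡ true
any-true⁺ p {i} pi = Equivalence.to Bool.T-≡ (Any.any⁺ p (lose (∈-allFin i) (Equivalence.from Bool.T-≡ pi)))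

any-true⁻ : (p : Fin l → Bool) → any p (allFin l) ≡ true → ∃ λ i → p i ≡ true
any-true⁻ p eq with Any.satisfied (Any.any⁻ p (allFin _) (Equivalence.from Bool.T-≡ eq))
... | i , Tpi = i , Equivalence.to Bool.T-≡ Tpi

all-true⁺ : (p : Fin l → Bool) → (∀ i → p i ≡ true) → all p (allFin l) ≡ true
all-true⁺ p f = Equivalence.to Bool.T-≡ (All.all⁻ p (All.universal (Equivalence.from Bool.T-≡ ∘ f) (allFin _)))

all-true⁻ : (p : Fin l → Bool) → all p (allFin l) ≡ true → ∀ i → p i ≡ true
all-true⁻ p eq i = Equivalence.to Bool.T-≡ (All.lookup (All.all⁺ p (allFin _) (Equivalence.from Bool.T-≡ eq)) (∈-allFin i))

∧-true⁻ : ∀ {a b} → a ∧ b ≡ true → a ≡ true × b ≡ true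
∧-true⁻ {true} {true} refl = refl , refl

∨-true⁻ : ∀ {a b} → a ∨ b ≡ true → a ≡ true ⊎ b ≡ true
∨-true⁻ {true}  eq = inj₁ refl
∨-true⁻ {false} eq = inj₂ eq

≟-true⁺ : {i j : Fin l} → i ≡ j → ⌊ i ≟ j ⌋ ≡ true
≟-true⁺ {i = i} {j} i≡j with i ≟ j
... | yes _   = refl
... | no i≢j = contradiction i≡j i≢j

≟-true⁻ : {i j : Fin l} → ⌊ i ≟ j ⌋ ≡ true → i ≡ j
≟-true⁻ {i = i} {j} eq with i ≟ j
... | yes i≡j = i≡j

exists-other : 2 ≤ l → (u : Fin l) → ∃ λ v → v ≢ u
exists-other (s≤s (s≤s _)) zero    = suc zero , λ ()
exists-other (s≤s (s≤s _)) (suc u) = zero , λ ()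

∣∣≡# : (S : Subset l) → ∣ S ∣ ≡ # (_∈? S)
∣∣≡# Vec.[]          = refl
∣∣≡# (true Vec.∷ S)  = cong suc (trans (∣∣≡# S) (sum-cong-≗ λ i →
  ⟦⟧-cong (i ∈? S) (suc i ∈? (true Vec.∷ S)) Vec.there λ { (Vec.there i∈S) → i∈S }))
∣∣≡# (false Vec.∷ S) = trans (∣∣≡# S) (sum-cong-≗ λ i →
  ⟦⟧-cong (i ∈? S) (suc i ∈? (false Vec.∷ S)) Vec.there λ { (Vec.there i∈S) → i∈S })

module _ {A : Pred (Fin l) 0ℓ} (A? : Decidable A) where

  toSubset : Subset l
  toSubset = Vec.tabulate (does ∘ A?)

  ∈-toSubset⁺ : ∀ {i} → A i → i ∈ toSubset
  ∈-toSubset⁺ {i} a = Vec.lookup⇒[]= i toSubset (trans (Vec.lookup∘tabulate (does ∘ A?) i) (dec-true (A? i) a))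

  ∈-toSubset⁻ : ∀ {i} → i ∈ toSubset → A i
  ∈-toSubset⁻ {i} i∈ with A? i | trans (sym (Vec.lookup∘tabulate (does ∘ A?) i)) (Vec.[]=⇒lookup i∈)
  ... | yes a | _ = a

  ∣toSubset∣ : ∣ toSubset ∣ ≡ # A?
  ∣toSubset∣ = trans (∣∣≡# toSubset) (sum-cong-≗ λ i → ⟦⟧-cong (i ∈? toSubset) (A? i) ∈-toSubset⁻ ∈-toSubset⁺)

-- A general `f` lets the induction pass to `f ∘ suc`; `boundarySize` is the case where `f` is the
-- identity.
length-filter-tabulate : (p : Fin m → Bool) (f : Fin l → Fin m) {A : Pred (Fin l) 0ℓ} (A? : Decidable A) →
  (∀ i → A i → p (f i) ≡ true) → (∀ i → p (f i) ≡ true → A i) →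
  length (filterᵇ p (tabulate f)) ≡ # A?
length-filter-tabulate {l = zero}  p f A? to from = refl
length-filter-tabulate {l = suc l} p f A? to from with p (f zero) in eq
... | true  = cong₂ _+_ (sym (⟦⟧-yes (A? zero) (from zero eq)))
  (length-filter-tabulate p (f ∘ suc) (A? ∘ suc) (to ∘ suc) (from ∘ suc))
... | false = cong₂ _+_ (sym (⟦⟧-no (A? zero) λ a → contradiction (trans (sym (to zero a)) eq) λ ()))
  (length-filter-tabulate p (f ∘ suc) (A? ∘ suc) (to ∘ suc) (from ∘ suc))

-- Graph distance

-- These local conditions determine `d`, since they make `reach G k u v` equivalent to `d u v ≤ k`.
-- A candidate such as the sum of two distances can therefore be identified with `dist` by checking
-- them.
record IsDistance (G : Graph) (d : V G → V G → ℕ) : Set where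
  field
    d-refl : ∀ u → d u u ≡ 0
    d-zero : ∀ {u v} → d u v ≡ 0 → u ≡ v
    d-step : ∀ u {w v} → adj G w v ≡ true → d u v ≤ suc (d u w)
    d-pred : ∀ {u v k} → d u v ≡ suc k → ∃ λ w → d u w ≡ k × adj G w v ≡ true

  -- A shortest path has a vertex at every distance from 0 to `d u v`; this injects
  -- `Fin (suc (d u v))` into the vertices.
  d-bounded : ∀ u v → d u v ≤ n G
  d-bounded u v = <⇒≤ (injective⇒≤ {f = λ i → proj₁ (at i)} λ {i} {j} eq →
    toℕ-injective (trans (sym (proj₂ (at i))) (trans (cong (d u) eq) (proj₂ (at j)))))
    where
    along : ∀ k {v} → d u v ≡ k → ∀ i → i ≤ k → ∃ λ w → d u w ≡ i
    along k       {v} eq i i≤k with m≤n⇒m<n∨m≡n i≤k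
    along k       {v} eq i i≤k | inj₂ refl = v , eq
    along (suc k) {v} eq i i≤k | inj₁ (s≤s i≤k′) with d-pred eq
    ... | w , eq′ , _ = along k eq′ i i≤k′
    at : (i : Fin (suc (d u v))) → ∃ λ w → d u w ≡ toℕ i
    at i = along (d u v) refl (toℕ i) (≤-pred (toℕ<n i))

  reach⇒≤ : ∀ k {u v} → reach G k u v ≡ true → d u v ≤ k
  reach⇒≤ zero    {u} {v} r with u ≟ v
  ... | yes refl = ≤-reflexive (d-refl u)
  reach⇒≤ (suc k) {u} {v} r with ∨-true⁻ {reach G k u v} r
  ... | inj₁ r′ = m≤n⇒m≤1+n (reach⇒≤ k r′)
  ... | inj₂ r′ with any-true⁻ (λ w → reach G k u w ∧ adj G w v) r′
  ... | w , e with ∧-true⁻ {reach G k u w} e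
  ... | r″ , w∼v = ≤-trans (d-step u w∼v) (s≤s (reach⇒≤ k r″))

  ≤⇒reach : ∀ k {u v} → d u v ≤ k → reach G k u v ≡ true
  ≤⇒reach zero    {u} {v} d≤0 with d-zero (n≤0⇒n≡0 d≤0)
  ... | refl with u ≟ u
  ... | yes _  = refl
  ... | no u≢u = contradiction refl u≢u
  ≤⇒reach (suc k) {u} {v} d≤1+k with m≤n⇒m<n∨m≡n d≤1+k
  ... | inj₁ (s≤s d≤k) rewrite ≤⇒reach k d≤k = refl
  ... | inj₂ d≡1+k with d-pred d≡1+k
  ... | w , dw≡k , w∼v = trans (cong (reach G k u v ∨_)
    (any-true⁺ (λ w → reach G k u w ∧ adj G w v) (cong₂ _∧_ (≤⇒reach k (≤-reflexive dw≡k)) w∼v))) (Bool.∨-zeroʳ (reach G k u v))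

module _ (G : Graph) (u v : V G) where

  mutual
    -- The private search function underlying dist cannot be named; it is recovered as the
    -- solution of the constraint that dist-unfold imposes on this metavariable. Abstracting over
    -- 1 and n G turns that constraint into a pattern; u≢v is abstracted too only because its
    -- type mentions n G, so that the abstraction would otherwise be ill-typed.
    search : ℕ → ℕ → ℕ
    search = _

    dist-unfold : dist G u v ≡ (if reach G 0 u v then 0 else search 1 (n G))
    dist-unfold with u ≟ v
    ... | yes _  = refl
    ... | no u≢v with u≢v | 1 | n G
    ... | _ | k | fuel = refl

module _ {G : Graph} {d : V G → V G → ℕ} (isDistance : IsDistance G d) where
  open IsDistance isDistance

  module _ (u v : V G) where

    -- The invariant of the upward scan is that `d u v` lies between `k` and `k + fuel`. A failed
    -- test raises the lower end; when the fuel is spent the ends meet, so the default answer `k` is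
    -- right.
    search-correct : ∀ k fuel → k ≤ d u v → d u v ≤ k + fuel → search G u v k fuel ≡ d u v
    search-correct k zero       k≤d d≤k+0 = ≤-antisym k≤d (≤-trans d≤k+0 (≤-reflexive (+-identityʳ k)))
    search-correct k (suc fuel) k≤d d≤k+f with reach G k u v in eq
    ... | true  = ≤-antisym k≤d (reach⇒≤ k eq)
    ... | false = search-correct (suc k) fuel
      (≰⇒> λ d≤k → contradiction (trans (sym (≤⇒reach k d≤k)) eq) λ ())
      (≤-trans d≤k+f (≤-reflexive (+-suc k fuel)))

    dist≡ : dist G u v ≡ d u v
    dist≡ = search-correct 0 (suc (n G)) z≤n (m≤n⇒m≤1+n (d-bounded u v))

  dist-isDistance : IsDistance G (dist G)
  dist-isDistance = record
    { d-refl = λ u → trans (dist≡ u u) (d-refl u)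
    ; d-zero = λ {u} {v} eq → d-zero (trans (sym (dist≡ u v)) eq)
    ; d-step = λ u {w} {v} w∼v → subst (λ k → dist G u v ≤ suc k) (sym (dist≡ u w))
                 (≤-trans (≤-reflexive (dist≡ u v)) (d-step u w∼v))
    ; d-pred = λ {u} {v} eq → let (w , e , w∼v) = d-pred (trans (sym (dist≡ u v)) eq) in w , trans (dist≡ u w) e , w∼v
    }

module _ {G : Graph} (connected : Connected G) where

  private
    reach-suc : ∀ k {u v} → reach G k u v ≡ true → reach G (suc k) u v ≡ true
    reach-suc k {u} {v} eq = cong (_∨ any (λ w → reach G k u w ∧ adj G w v) (allFin (n G))) eq

    reach-mono : ∀ {j k u v} → j ≤ k → reach G j u v ≡ true → reach G k u v ≡ true
    reach-mono {j} {k} j≤k eq with m≤n⇒m<n∨m≡n j≤k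
    ... | inj₂ refl = eq
    reach-mono {j} {suc k} _ eq | inj₁ (s≤s j≤k) = reach-suc k (reach-mono j≤k eq)

    -- Descends from a known walk length; by monotonicity of `reach`, the first failure at `k` shows
    -- that no length below `suc k` works.
    least : ∀ {u v} k → reach G k u v ≡ true → ∃ λ j → reach G j u v ≡ true × (∀ i → reach G i u v ≡ true → j ≤ i)
    least         zero    eq = 0 , eq , λ _ _ → z≤n
    least {u} {v} (suc k) eq with reach G k u v in eq′
    ... | true  = least k eq′
    ... | false = suc k , reach-suc′ , λ i r → ≰⇒> λ i≤k → contradiction (trans (sym (reach-mono i≤k r)) eq′) λ ()
      where
      reach-suc′ : reach G (suc k) u v ≡ true
      reach-suc′ rewrite eq′ = eq

    least-reach : ∀ u v → ∃ λ j → reach G j u v ≡ true × (∀ i → reach G i u v ≡ true → j ≤ i)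
    least-reach u v = least (proj₁ (connected u v)) (proj₂ (connected u v))

    -- The distance read off from the connectivity witnesses. Once it satisfies `IsDistance`, the
    -- search that defines `dist` is known to return the same value.
    δ : V G → V G → ℕ
    δ u v = proj₁ (least-reach u v)

    δ-reach : ∀ u v → reach G (δ u v) u v ≡ true
    δ-reach u v = proj₁ (proj₂ (least-reach u v))

    δ-least : ∀ u v i → reach G i u v ≡ true → δ u v ≤ i
    δ-least u v = proj₂ (proj₂ (least-reach u v))

    δ-refl : ∀ u → δ u u ≡ 0
    δ-refl u = n≤0⇒n≡0 (δ-least u u 0 reach₀)
      where
      reach₀ : reach G 0 u u ≡ true
      reach₀ with u ≟ u
      ... | yes _  = refl
      ... | no u≢u = contradiction refl u≢u

    δ-zero : ∀ {u v} → δ u v ≡ 0 → u ≡ v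
    δ-zero {u} {v} eq with u ≟ v | subst (λ k → reach G k u v ≡ true) eq (δ-reach u v)
    ... | yes u≡v | _ = u≡v

    δ-step : ∀ u {w v} → adj G w v ≡ true → δ u v ≤ suc (δ u w)
    δ-step u {w} {v} w∼v = δ-least u v (suc (δ u w))
      (trans (cong (reach G (δ u w) u v ∨_) (any-true⁺ (λ x → reach G (δ u w) u x ∧ adj G x v) {w} (cong₂ _∧_ (δ-reach u w) w∼v)))
             (Bool.∨-zeroʳ (reach G (δ u w) u v)))

    δ-pred : ∀ {u v k} → δ u v ≡ suc k → ∃ λ w → δ u w ≡ k × adj G w v ≡ true
    δ-pred {u} {v} {k} eq with ∨-true⁻ {reach G k u v} (subst (λ k → reach G k u v ≡ true) eq (δ-reach u v))
    ... | inj₁ r = contradiction (≤-trans (≤-reflexive (sym eq)) (δ-least u v k r)) 1+n≰n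
    ... | inj₂ r with any-true⁻ (λ w → reach G k u w ∧ adj G w v) r
    ... | w , e with ∧-true⁻ {reach G k u w} e
    ... | r′ , w∼v = w , ≤-antisym (δ-least u w k r′) (≤-pred (≤-trans (≤-reflexive (sym eq)) (δ-step u w∼v))) , w∼v

  connected⇒isDistance : IsDistance G (dist G)
  connected⇒isDistance = dist-isDistance record { d-refl = δ-refl ; d-zero = δ-zero ; d-step = δ-step ; d-pred = δ-pred }

-- Mutually maximally distant vertices

module MutuallyMaximallyDistant (G : Graph)
  (adj-sym : ∀ u v → adj G u v ≡ adj G v u) (isDistance : IsDistance G (dist G)) where
  open IsDistance isDistance

  d : V G → V G → ℕ
  d = dist G

  triangle : ∀ u v w → d u w ≤ d u v + d v w
  triangle u v w = go (d v w) {w} refl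
    where
    go : ∀ k {w} → d v w ≡ k → d u w ≤ d u v + k
    go zero    eq with d-zero eq
    ... | refl = m≤m+n _ 0
    go (suc k) eq with d-pred eq
    ... | w′ , eq′ , w′∼w = ≤-trans (d-step u w′∼w) (≤-trans (s≤s (go k eq′)) (≤-reflexive (sym (+-suc (d u v) k))))

  d-adjacent : ∀ {u v} → adj G u v ≡ true → d u v ≤ 1
  d-adjacent {u} u∼v = ≤-trans (d-step u u∼v) (s≤s (≤-reflexive (d-refl u)))

  -- The conditions of `IsDistance` speak of the far end of a path only. The last edge of a shortest
  -- path to `u` is removed, reversed by `adj-sym`, and put in front by `triangle`.
  d-sym : ∀ u v → d u v ≡ d v u
  d-sym u v = ≤-antisym (half (d v u) u refl) (half (d u v) v refl)
    where
    half : ∀ k u {v} → d v u ≡ k → d u v ≤ k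
    half zero    u eq with d-zero eq
    ... | refl = ≤-reflexive eq
    half (suc k) u {v} eq with d-pred eq
    ... | w , eq′ , w∼u = ≤-trans (triangle u w v) (+-mono-≤ (d-adjacent (trans (adj-sym u w) w∼u)) (half k w eq′))

  private
    not-∨⁺ : ∀ {a b} → (a ≡ true → b ≡ true) → not a ∨ b ≡ true
    not-∨⁺ {true}  f = f refl
    not-∨⁺ {false} f = refl

    not-∨⁻ : ∀ {a b} → not a ∨ b ≡ true → a ≡ true → b ≡ true
    not-∨⁻ eq refl = eq

  maxDist⁺ : ∀ {u v} → (∀ w → adj G u w ≡ true → d v w ≤ d u v) → maxDist G u v ≡ true
  maxDist⁺ f = all-true⁺ _ λ w → not-∨⁺ λ u∼w → Equivalence.to Bool.T-≡ (≤⇒≤ᵇ (f w u∼w))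

  maxDist⁻ : ∀ {u v} → maxDist G u v ≡ true → ∀ w → adj G u w ≡ true → d v w ≤ d u v
  maxDist⁻ eq w u∼w = ≤ᵇ⇒≤ _ _ (Equivalence.from Bool.T-≡ (not-∨⁻ (all-true⁻ _ eq w) u∼w))

  _∼_ : V G → V G → Set
  u ∼ v = mutMaxDist G u v ≡ true

  ∼-sym : ∀ {u v} → u ∼ v → v ∼ u
  ∼-sym {u} {v} u∼v = trans (Bool.∧-comm (maxDist G v u) (maxDist G u v)) u∼v

  SR : SymGraph (n G)
  SR = record { _∼_ = _∼_ ; _∼?_ = λ u v → mutMaxDist G u v Bool.≟ true ; ∼-sym = ∼-sym }

  open SymGraph SR using (∂; ∂?; Cover; CoverNumber; Transitive; Automorphism)

  boundarySize≡ : boundarySize G ≡ # ∂?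
  boundarySize≡ = length-filter-tabulate (inBoundary G) id ∂?
    (λ u (v , u∼v) → any-true⁺ (mutMaxDist G u) u∼v) (λ u → any-true⁻ (mutMaxDist G u))

  -- As long as `v` has a neighbour farther from `u`, move there, which prolongs a shortest path.
  -- The invariant `n G ≤ d u v + fuel` makes the fuel sufficient: once it is spent, a farther
  -- neighbour would violate `d-bounded`.
  extend : ∀ u v → ∃ λ v′ → d u v + d v v′ ≡ d u v′ × maxDist G v′ u ≡ true
  extend u v = go (n G) v (m≤n+m (n G) (d u v))
    where
    open ≤-Reasoning
    go : ∀ fuel v → n G ≤ d u v + fuel → ∃ λ v′ → d u v + d v v′ ≡ d u v′ × maxDist G v′ u ≡ true
    go fuel v bound with any? (λ w → (adj G v w Bool.≟ true) ×-dec (suc (d v u) ≤? d u w))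
    ... | no stuck = v , trans (cong (d u v +_) (d-refl v)) (+-identityʳ _) ,
      maxDist⁺ λ w v∼w → ≮⇒≥ λ farther → stuck (w , v∼w , farther)
    go zero       v bound | yes (w , v∼w , farther) = contradiction
      (begin-strict
        d u v      ≡⟨ d-sym u v ⟩
        d v u      <⟨ farther ⟩
        d u w      ≤⟨ d-bounded u w ⟩
        n G        ≤⟨ bound ⟩
        d u v + 0  ≡⟨ +-identityʳ _ ⟩
        d u v      ∎) (<-irrefl refl)
    go (suc fuel) v bound | yes (w , v∼w , farther) =
      let farther′ : suc (d u v) ≤ d u w
          farther′ = ≤-trans (s≤s (≤-reflexive (d-sym u v))) farther
          (v′ , between , maximal) = go fuel w (begin
            n G                   ≤⟨ bound ⟩
            d u v + suc fuel      ≡⟨ +-suc _ fuel ⟩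
            suc (d u v) + fuel    ≤⟨ +-monoˡ-≤ fuel farther′ ⟩
            d u w + fuel          ∎)
      in v′ , ≤-antisym (begin
            d u v + d v v′              ≤⟨ +-monoʳ-≤ (d u v) (triangle v w v′) ⟩
            d u v + (d v w + d w v′)    ≤⟨ +-monoʳ-≤ (d u v) (+-monoˡ-≤ (d w v′) (d-adjacent v∼w)) ⟩
            d u v + suc (d w v′)        ≡⟨ +-suc (d u v) (d w v′) ⟩
            suc (d u v) + d w v′        ≤⟨ +-monoˡ-≤ (d w v′) farther′ ⟩
            d u w + d w v′              ≡⟨ between ⟩
            d u v′                      ∎) (triangle u v v′) , maximal

  -- A shortest path from `u` to `v` is prolonged beyond `v` to `v′`, then beyond `u` to `u′`. The
  -- vertex `v′` stays maximally distant from `u′`, since `u` lies between them; so the cover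
  -- contains `u′` or `v′`, and either one resolves `u` and `v`.
  cover⇒resolving : (S : Subset (n G)) → Cover (_∈ S) → IsStrongResolvingSet G S
  cover⇒resolving S cover u v _ with extend u v
  ... | v′ , uvv′ , v′-max with extend v′ u
  ... | u′ , v′uu′ , u′-max with cover u′ v′ (cong₂ _∧_ u′-max (maxDist⁺ λ w v′∼w → begin
        d u′ w           ≤⟨ triangle u′ u w ⟩
        d u′ u + d u w   ≤⟨ +-monoʳ-≤ (d u′ u) (maxDist⁻ v′-max w v′∼w) ⟩
        d u′ u + d v′ u  ≡⟨ +-comm (d u′ u) (d v′ u) ⟩
        d v′ u + d u′ u  ≡⟨ cong (d v′ u +_) (d-sym u′ u) ⟩
        d v′ u + d u u′  ≡⟨ v′uu′ ⟩
        d v′ u′          ∎))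
    where open ≤-Reasoning
  ... | inj₂ v′∈S = v′ , v′∈S , inj₁ uvv′
  -- The vertices `v′`, `v`, `u`, `u′` lie in this order on a shortest path; cancelling `d v′ v`
  -- leaves `u` between `v` and `u′`.
  ... | inj₁ u′∈S = u′ , u′∈S , inj₂ (≤-antisym (+-cancelˡ-≤ (d v′ v) _ _ (begin
        d v′ v + (d v u + d u u′)  ≡⟨ sym (+-assoc (d v′ v) (d v u) (d u u′)) ⟩
        d v′ v + d v u + d u u′    ≡⟨ cong (_+ d u u′) (+-comm (d v′ v) (d v u)) ⟩
        d v u + d v′ v + d u u′    ≡⟨ cong (_+ d u u′) (cong₂ _+_ (d-sym v u) (d-sym v′ v)) ⟩
        d u v + d v v′ + d u u′    ≡⟨ cong (_+ d u u′) (trans uvv′ (d-sym u v′)) ⟩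
        d v′ u + d u u′            ≡⟨ v′uu′ ⟩
        d v′ u′                    ≤⟨ triangle v′ v u′ ⟩
        d v′ v + d v u′            ∎)) (triangle v u u′))
    where open ≤-Reasoning

  -- Otherwise let `x` be the next vertex from `v` towards `w`. It is no farther from `u` than `v`
  -- is, so going through `x` would be shorter than `d u w`.
  maximal-endpoint : ∀ {u v w} → maxDist G v u ≡ true → InInterval G v u w → v ≡ w
  maximal-endpoint {u} {v} {w} v-max between with d w v in eq
  ... | zero  = sym (d-zero eq)
  ... | suc k with d-pred eq
  ... | x , eq′ , x∼v = contradiction (begin-strict
        d u w             ≤⟨ triangle u x w ⟩
        d u x + d x w     ≤⟨ +-mono-≤ (maxDist⁻ v-max x (trans (adj-sym v x) x∼v)) (≤-reflexive (trans (d-sym x w) eq′)) ⟩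
        d v u + k         <⟨ +-monoʳ-< (d v u) (n<1+n k) ⟩
        d v u + suc k     ≡⟨ cong₂ _+_ (d-sym v u) (sym (trans (d-sym v w) eq)) ⟩
        d u v + d v w     ≡⟨ between ⟩
        d u w             ∎) (<-irrefl refl)
    where open ≤-Reasoning

  module _ (∼-irrefl : ∀ u → ¬ (u ∼ u)) where

    -- By `maximal-endpoint` only `u` and `v` themselves can resolve a mutually maximally distant
    -- pair. Irreflexivity supplies the `u ≢ v` under which `S` resolves.
    resolving⇒cover : (S : Subset (n G)) → IsStrongResolvingSet G S → Cover (_∈ S)
    resolving⇒cover S resolving u v u∼v with resolving u v (λ { refl → ∼-irrefl u u∼v })
    ... | w , w∈S , inj₁ uvw with maximal-endpoint (proj₂ (∧-true⁻ {maxDist G u v} u∼v)) uvw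
    ...   | refl = inj₂ w∈S
    resolving⇒cover S resolving u v u∼v | w , w∈S , inj₂ vuw with maximal-endpoint (proj₁ (∧-true⁻ {maxDist G u v} u∼v)) vuw
    ...   | refl = inj₁ w∈S

    dim⇒coverNumber : ∀ {k} → IsStrongMetricDim G k → CoverNumber k
    dim⇒coverNumber ((S , resolving , ∣S∣≡k) , minimal) = record
      { C? = _∈? S
      ; cover = resolving⇒cover S resolving
      ; size = trans (sym (∣∣≡# S)) ∣S∣≡k
      ; minimal = λ D? D-cover → ≤-trans (minimal (toSubset D?) (cover⇒resolving (toSubset D?) (toSubset-cover D? D-cover)))
          (≤-reflexive (∣toSubset∣ D?))
      }
      where
      toSubset-cover : {D : Pred (V G) 0ℓ} (D? : Decidable D) → Cover D → Cover (_∈ toSubset D?)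
      toSubset-cover D? D-cover u v u∼v with D-cover u v u∼v
      ... | inj₁ u∈D = inj₁ (∈-toSubset⁺ D? u∈D)
      ... | inj₂ v∈D = inj₂ (∈-toSubset⁺ D? v∈D)

    coverNumber⇒dim : ∀ {k} → CoverNumber k → IsStrongMetricDim G k
    coverNumber⇒dim coverNumber =
      (toSubset C? , cover⇒resolving (toSubset C?) toSubset-cover , trans (∣toSubset∣ C?) size) ,
      λ S resolving → ≤-trans (minimal (_∈? S) (resolving⇒cover S resolving)) (≤-reflexive (sym (∣∣≡# S)))
      where
      open SymGraph.CoverNumber coverNumber
      toSubset-cover : Cover (_∈ toSubset C?)
      toSubset-cover u v u∼v with cover u v u∼v
      ... | inj₁ u∈C = inj₁ (∈-toSubset⁺ C? u∈C)
      ... | inj₂ v∈C = inj₂ (∈-toSubset⁺ C? v∈C)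

  -- If `u ∼ u`, every neighbour of `u` is at distance 0 and thus a loop. A second vertex guarantees
  -- that `u` has a neighbour; in the one-vertex graph `u ∼ u` does hold.
  ∼-irreflexive : (∀ u → adj G u u ≡ false) → 2 ≤ n G → ∀ u → ¬ (u ∼ u)
  ∼-irreflexive loopless 2≤n u u∼u with exists-other 2≤n u
  ... | v , v≢u with d v u in eq
  ... | zero  = v≢u (d-zero eq)
  ... | suc k with d-pred eq
  ... | w , _ , w∼u with d-zero (n≤0⇒n≡0 (≤-trans
    (maxDist⁻ (proj₁ (∧-true⁻ {maxDist G u u} u∼u)) w (trans (adj-sym u w) w∼u))
    (≤-reflexive (d-refl u))))
  ... | refl = contradiction (trans (sym w∼u) (loopless u)) λ ()

  -- The given bijections act on the boundary only. Extending them by the identity yields a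
  -- permutation of all vertices, and edges see just its boundary part.
  SR-transitive : SRVertexTransitive G → Transitive
  SR-transitive transitive x y (x′ , x∼x′) (y′ , y∼y′)
    with transitive x y (any-true⁺ (mutMaxDist G x) x∼x′) (any-true⁺ (mutMaxDist G y) y∼y′)
  ... | φ , ψ , φ-∂ , ψ-∂ , ψφ , φψ , φ-∼ , φx≡y = record
    { perm  = permutation φ⁺ ψ⁺ (cancel φ ψ ψ-∂ φψ) (cancel ψ φ φ-∂ ψφ)
    ; hom   = λ u v u∼v → subst₂-∼ (φ⁺≡ u v u∼v) (φ⁺≡ v u (∼-sym u∼v))
                (trans (φ-∼ u v (b u v u∼v) (b v u (∼-sym u∼v))) u∼v)
    ; hom⁻¹ = λ u v u∼v → subst₂-∼ (ψ⁺≡ u v u∼v) (ψ⁺≡ v u (∼-sym u∼v))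
                (trans (sym (φ-∼ (ψ u) (ψ v) (ψ-∂ u (b u v u∼v)) (ψ-∂ v (b v u (∼-sym u∼v)))))
                  (trans (cong₂ (mutMaxDist G) (φψ u (b u v u∼v)) (φψ v (b v u (∼-sym u∼v)))) u∼v))
    } , trans (φ⁺≡ x x′ x∼x′) φx≡y
    where
    extendByIdentity : (V G → V G) → V G → V G
    extendByIdentity f u = if inBoundary G u then f u else u
    φ⁺ ψ⁺ : V G → V G
    φ⁺ = extendByIdentity φ
    ψ⁺ = extendByIdentity ψ
    b : ∀ u v → u ∼ v → inBoundary G u ≡ true
    b u v u∼v = any-true⁺ (mutMaxDist G u) u∼v
    on-∂ : ∀ f u → inBoundary G u ≡ true → extendByIdentity f u ≡ f u
    on-∂ f u eq rewrite eq = refl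
    φ⁺≡ : ∀ u v → u ∼ v → φ⁺ u ≡ φ u
    φ⁺≡ u v u∼v = on-∂ φ u (b u v u∼v)
    ψ⁺≡ : ∀ u v → u ∼ v → ψ⁺ u ≡ ψ u
    ψ⁺≡ u v u∼v = on-∂ ψ u (b u v u∼v)
    subst₂-∼ : ∀ {u u′ v v′} → u ≡ u′ → v ≡ v′ → u′ ∼ v′ → u ∼ v
    subst₂-∼ refl refl e = e
    cancel : ∀ f g → (∀ u → inBoundary G u ≡ true → inBoundary G (g u) ≡ true) →
      (∀ u → inBoundary G u ≡ true → f (g u) ≡ u) → ∀ u → extendByIdentity f (extendByIdentity g u) ≡ u
    cancel f g g-∂ fg u with inBoundary G u in eq
    ... | true  = trans (on-∂ f (g u) (g-∂ u eq)) (fg u eq)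
    ... | false rewrite eq = refl

-- Cartesian products

module _ (G H : Graph) where

  private
    fst : V (G □ H) → V G
    fst i = proj₁ (remQuot {n G} (n H) i)

    snd : V (G □ H) → V H
    snd i = proj₂ (remQuot {n G} (n H) i)

    fst-combine : (a : V G) (b : V H) → fst (combine a b) ≡ a
    fst-combine a b = cong proj₁ (remQuot-combine a b)

    snd-combine : (a : V G) (b : V H) → snd (combine a b) ≡ b
    snd-combine a b = cong proj₂ (remQuot-combine a b)

    □-ext : ∀ {i j} → fst i ≡ fst j → snd i ≡ snd j → i ≡ j
    □-ext {i} {j} e e′ = trans (sym (combine-remQuot {n G} (n H) i)) (trans (cong₂ combine e e′) (combine-remQuot {n G} (n H) j))

  adj-□⁻ : ∀ i j → adj (G □ H) i j ≡ true →
    (fst i ≡ fst j × adj H (snd i) (snd j) ≡ true) ⊎ (snd i ≡ snd j × adj G (fst i) (fst j) ≡ true)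
  adj-□⁻ i j eq with ∨-true⁻ {⌊ fst i ≟ fst j ⌋ ∧ adj H (snd i) (snd j)} eq
  ... | inj₁ e with ∧-true⁻ {⌊ fst i ≟ fst j ⌋} e
  ...   | e₁ , e₂ = inj₁ (≟-true⁻ e₁ , e₂)
  adj-□⁻ i j eq | inj₂ e with ∧-true⁻ {⌊ snd i ≟ snd j ⌋} e
  ...   | e₁ , e₂ = inj₂ (≟-true⁻ e₁ , e₂)

  adj-□⁺ʳ : ∀ i j → fst i ≡ fst j → adj H (snd i) (snd j) ≡ true → adj (G □ H) i j ≡ true
  adj-□⁺ʳ i j e a = cong (_∨ (⌊ snd i ≟ snd j ⌋ ∧ adj G (fst i) (fst j))) (cong₂ _∧_ (≟-true⁺ e) a)

  adj-□⁺ˡ : ∀ i j → snd i ≡ snd j → adj G (fst i) (fst j) ≡ true → adj (G □ H) i j ≡ true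
  adj-□⁺ˡ i j e a = trans
    (cong ((⌊ fst i ≟ fst j ⌋ ∧ adj H (snd i) (snd j)) ∨_) (cong₂ _∧_ (≟-true⁺ e) a))
    (Bool.∨-zeroʳ (⌊ fst i ≟ fst j ⌋ ∧ adj H (snd i) (snd j)))

  □-adj-sym : (∀ u v → adj G u v ≡ adj G v u) → (∀ u v → adj H u v ≡ adj H v u) →
    ∀ i j → adj (G □ H) i j ≡ adj (G □ H) j i
  □-adj-sym symᴳ symᴴ i j = Bool.⇔→≡ {z = true} (mk⇔ (half i j) (half j i))
    where
    half : ∀ i j → adj (G □ H) i j ≡ true → adj (G □ H) j i ≡ true
    half i j e with adj-□⁻ i j e
    ... | inj₁ (e₁ , e₂) = adj-□⁺ʳ j i (sym e₁) (trans (symᴴ _ _) e₂)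
    ... | inj₂ (e₁ , e₂) = adj-□⁺ˡ j i (sym e₁) (trans (symᴳ _ _) e₂)

  module _ {dᴳ : V G → V G → ℕ} {dᴴ : V H → V H → ℕ} (isDistanceᴳ : IsDistance G dᴳ) (isDistanceᴴ : IsDistance H dᴴ) where

    private
      module 𝔾 = IsDistance isDistanceᴳ
      module ℍ = IsDistance isDistanceᴴ

      d+ : V (G □ H) → V (G □ H) → ℕ
      d+ i j = dᴳ (fst i) (fst j) + dᴴ (snd i) (snd j)

      d+-step : ∀ i {j k} → adj (G □ H) j k ≡ true → d+ i k ≤ suc (d+ i j)
      d+-step i {j} {k} j∼k with adj-□⁻ j k j∼k
      ... | inj₁ (e , a) = ≤-trans (+-mono-≤ (≤-reflexive (cong (dᴳ (fst i)) (sym e))) (ℍ.d-step (snd i) a))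
        (≤-reflexive (+-suc _ _))
      ... | inj₂ (e , a) = +-mono-≤ (𝔾.d-step (fst i) a) (≤-reflexive (cong (dᴴ (snd i)) (sym e)))

      d+-pred : ∀ {i j k} → d+ i j ≡ suc k → ∃ λ w → d+ i w ≡ k × adj (G □ H) w j ≡ true
      d+-pred {i} {j} {k} eq with dᴳ (fst i) (fst j) in eq₁
      -- The last edge of the path is taken in `H` when the first coordinates are at distance 0, and
      -- in `G` otherwise.
      ... | zero with ℍ.d-pred eq
      ...   | b , e , b∼ = combine (fst j) b ,
        cong₂ _+_ (trans (cong (dᴳ (fst i)) (fst-combine (fst j) b)) eq₁)
          (trans (cong (dᴴ (snd i)) (snd-combine (fst j) b)) e) ,
        adj-□⁺ʳ (combine (fst j) b) j (fst-combine (fst j) b)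
          (trans (cong (λ x → adj H x (snd j)) (snd-combine (fst j) b)) b∼)
      d+-pred {i} {j} {k} eq | suc l with 𝔾.d-pred eq₁
      ...   | a , e , a∼ = combine a (snd j) ,
        trans (cong₂ _+_ (trans (cong (dᴳ (fst i)) (fst-combine a (snd j))) e) (cong (dᴴ (snd i)) (snd-combine a (snd j))))
          (suc-injective eq) ,
        adj-□⁺ˡ (combine a (snd j)) j (snd-combine a (snd j))
          (trans (cong (λ x → adj G x (fst j)) (fst-combine a (snd j))) a∼)

    □-isDistance : IsDistance (G □ H) d+
    □-isDistance = record
      { d-refl = λ i → cong₂ _+_ (𝔾.d-refl (fst i)) (ℍ.d-refl (snd i))
      ; d-zero = λ {i} {j} eq → □-ext (𝔾.d-zero (m+n≡0⇒m≡0 _ eq)) (ℍ.d-zero (m+n≡0⇒n≡0 (dᴳ (fst i) (fst j)) eq))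
      ; d-step = d+-step
      ; d-pred = d+-pred
      }

  -- The strong resolving graph of a Cartesian product

  module □-StrongDimension
    (simpleᴳ : IsSimple G) (simpleᴴ : IsSimple H)
    (isDistanceᴳ : IsDistance G (dist G)) (isDistanceᴴ : IsDistance H (dist H)) where

    module 𝔾 = MutuallyMaximallyDistant G (proj₁ simpleᴳ) isDistanceᴳ
    module ℍ = MutuallyMaximallyDistant H (proj₁ simpleᴴ) isDistanceᴴ
    module ℙ = MutuallyMaximallyDistant (G □ H) (□-adj-sym (proj₁ simpleᴳ) (proj₁ simpleᴴ))
      (dist-isDistance (□-isDistance isDistanceᴳ isDistanceᴴ))

    private
      dist-□ : ∀ i j → dist (G □ H) i j ≡ dist G (fst i) (fst j) + dist H (snd i) (snd j)
      dist-□ = dist≡ (□-isDistance isDistanceᴳ isDistanceᴴ)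

    -- An edge of the product moves one coordinate, and the distance in the other is unchanged.
    maxDist-□⁺ : ∀ i j → maxDist G (fst i) (fst j) ≡ true → maxDist H (snd i) (snd j) ≡ true → maxDist (G □ H) i j ≡ true
    maxDist-□⁺ i j maxᴳ maxᴴ = ℙ.maxDist⁺ bound
      where
      bound : ∀ k → adj (G □ H) i k ≡ true → dist (G □ H) j k ≤ dist (G □ H) i j
      bound k i∼k rewrite dist-□ j k | dist-□ i j with adj-□⁻ i k i∼k
      ... | inj₁ (e , a) = +-mono-≤
        (≤-reflexive (trans (𝔾.d-sym (fst j) (fst k)) (cong (λ x → dist G x (fst j)) (sym e))))
        (ℍ.maxDist⁻ maxᴴ (snd k) a)
      ... | inj₂ (e , a) = +-mono-≤
        (𝔾.maxDist⁻ maxᴳ (fst k) a)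
        (≤-reflexive (trans (ℍ.d-sym (snd j) (snd k)) (cong (λ x → dist H x (snd j)) (sym e))))

    -- A neighbour `a` of `fst i` lifts to the neighbour `combine a (snd i)` of `i`; the summand
    -- from `H` then cancels.
    maxDist-□⁻ˡ : ∀ i j → maxDist (G □ H) i j ≡ true → maxDist G (fst i) (fst j) ≡ true
    maxDist-□⁻ˡ i j max = 𝔾.maxDist⁺ λ a i∼a → +-cancelʳ-≤ (dist H (snd i) (snd j)) _ _ (begin
      dist G (fst j) a + dist H (snd i) (snd j)
        ≡⟨ cong (dist G (fst j) a +_) (ℍ.d-sym (snd i) (snd j)) ⟩
      dist G (fst j) a + dist H (snd j) (snd i)
        ≡⟨ cong₂ (λ x y → dist G (fst j) x + dist H (snd j) y) (sym (fst-combine a (snd i))) (sym (snd-combine a (snd i))) ⟩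
      dist G (fst j) (fst (combine a (snd i))) + dist H (snd j) (snd (combine a (snd i)))
        ≡⟨ sym (dist-□ j (combine a (snd i))) ⟩
      dist (G □ H) j (combine a (snd i))
        ≤⟨ ℙ.maxDist⁻ max (combine a (snd i)) (adj-□⁺ˡ i (combine a (snd i)) (sym (snd-combine a (snd i)))
             (trans (cong (adj G (fst i)) (fst-combine a (snd i))) i∼a)) ⟩
      dist (G □ H) i j
        ≡⟨ dist-□ i j ⟩
      dist G (fst i) (fst j) + dist H (snd i) (snd j) ∎)
      where open ≤-Reasoning

    maxDist-□⁻ʳ : ∀ i j → maxDist (G □ H) i j ≡ true → maxDist H (snd i) (snd j) ≡ true
    maxDist-□⁻ʳ i j max = ℍ.maxDist⁺ λ b i∼b → +-cancelˡ-≤ (dist G (fst i) (fst j)) _ _ (begin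
      dist G (fst i) (fst j) + dist H (snd j) b
        ≡⟨ cong (_+ dist H (snd j) b) (𝔾.d-sym (fst i) (fst j)) ⟩
      dist G (fst j) (fst i) + dist H (snd j) b
        ≡⟨ cong₂ (λ x y → dist G (fst j) x + dist H (snd j) y) (sym (fst-combine (fst i) b)) (sym (snd-combine (fst i) b)) ⟩
      dist G (fst j) (fst (combine (fst i) b)) + dist H (snd j) (snd (combine (fst i) b))
        ≡⟨ sym (dist-□ j (combine (fst i) b)) ⟩
      dist (G □ H) j (combine (fst i) b)
        ≤⟨ ℙ.maxDist⁻ max (combine (fst i) b) (adj-□⁺ʳ i (combine (fst i) b) (sym (fst-combine (fst i) b))
             (trans (cong (adj H (snd i)) (snd-combine (fst i) b)) i∼b)) ⟩
      dist (G □ H) i j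
        ≡⟨ dist-□ i j ⟩
      dist G (fst i) (fst j) + dist H (snd i) (snd j) ∎)
      where open ≤-Reasoning

    ∼-□⁻ : ∀ i j → i ℙ.∼ j → (fst i 𝔾.∼ fst j) × (snd i ℍ.∼ snd j)
    ∼-□⁻ i j i∼j with ∧-true⁻ {maxDist (G □ H) i j} i∼j
    ... | e , e′ = cong₂ _∧_ (maxDist-□⁻ˡ i j e) (maxDist-□⁻ˡ j i e′) , cong₂ _∧_ (maxDist-□⁻ʳ i j e) (maxDist-□⁻ʳ j i e′)

    ∼-□⁺ : ∀ i j → fst i 𝔾.∼ fst j → snd i ℍ.∼ snd j → i ℙ.∼ j
    ∼-□⁺ i j x y with ∧-true⁻ {maxDist G (fst i) (fst j)} x | ∧-true⁻ {maxDist H (snd i) (snd j)} y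
    ... | x₁ , x₂ | y₁ , y₂ = cong₂ _∧_ (maxDist-□⁺ i j x₁ y₁) (maxDist-□⁺ j i x₂ y₂)

    combine-∼ : ∀ {a a′ b b′} → a 𝔾.∼ a′ → b ℍ.∼ b′ → combine a b ℙ.∼ combine a′ b′
    combine-∼ {a} {a′} {b} {b′} a∼a′ b∼b′ = ∼-□⁺ (combine a b) (combine a′ b′)
      (trans (cong₂ (mutMaxDist G) (fst-combine a b) (fst-combine a′ b′)) a∼a′)
      (trans (cong₂ (mutMaxDist H) (snd-combine a b) (snd-combine a′ b′)) b∼b′)

    #-□ : {A : Pred (V G) 0ℓ} {B : Pred (V H) 0ℓ} (A? : Decidable A) (B? : Decidable B) →
      # (λ i → A? (fst i) ×-dec B? (snd i)) ≡ # A? * # B?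
    #-□ {A} {B} A? B? = trans (∑-combine (n G) (λ i → ⟦ A? (fst i) ×-dec B? (snd i) ⟧)) (trans
      (sum-cong-≗ λ a → sum-cong-≗ λ b → ⟦⟧-cong (A? (fst (combine a b)) ×-dec B? (snd (combine a b))) (A? a ×-dec B? b)
        (λ (x , y) → subst A (fst-combine a b) x , subst B (snd-combine a b) y)
        (λ (x , y) → subst A (sym (fst-combine a b)) x , subst B (sym (snd-combine a b)) y))
      (#-× A? B?))

    module _ (transitiveᴳ : SymGraph.Transitive 𝔾.SR) (transitiveᴴ : SymGraph.Transitive ℍ.SR)
      {βᴳ βᴴ : ℕ} (coverᴳ : SymGraph.CoverNumber 𝔾.SR βᴳ) (coverᴴ : SymGraph.CoverNumber ℍ.SR βᴴ) where

      private
        p q : ℕ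
        p = # (SymGraph.∂? 𝔾.SR)
        q = # (SymGraph.∂? ℍ.SR)

        lower-bound : {D : Pred (V (G □ H)) 0ℓ} (D? : Decidable D) → SymGraph.Cover ℙ.SR D → (p * βᴴ) ⊓ (q * βᴳ) ≤ # D?
        lower-bound D? D-cover = ≤-trans
          (product-cover-bound 𝔾.SR ℍ.SR transitiveᴳ transitiveᴴ coverᴳ coverᴴ (λ a b → D? (combine a b))
            (λ a∼a′ b∼b′ → D-cover _ _ (combine-∼ a∼a′ b∼b′)))
          (≤-reflexive (sym (∑-combine (n G) (λ i → ⟦ D? i ⟧))))

      -- The bound is attained by the boundary of one factor times a minimum cover of the other,
      -- whichever is smaller: an edge of the product projects to an edge in each factor, so it is
      -- enough to cover one projection.
      coverNumber-□ : SymGraph.CoverNumber ℙ.SR ((p * βᴴ) ⊓ (q * βᴳ))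
      coverNumber-□ with ⊓-sel (p * βᴴ) (q * βᴳ)
      ... | inj₁ min≡ = record
        { C? = λ i → SymGraph.∂? 𝔾.SR (fst i) ×-dec C? (snd i)
        ; cover = ∂×C-cover
        ; size = trans (#-□ (SymGraph.∂? 𝔾.SR) C?) (trans (cong (p *_) size) (sym min≡))
        ; minimal = lower-bound
        }
        where
        open SymGraph.CoverNumber coverᴴ
        ∂×C-cover : SymGraph.Cover ℙ.SR λ i → SymGraph.∂ 𝔾.SR (fst i) × C (snd i)
        ∂×C-cover i j i∼j with ∼-□⁻ i j i∼j
        ... | a∼a′ , b∼b′ with cover (snd i) (snd j) b∼b′
        ... | inj₁ ∈C = inj₁ ((fst j , a∼a′) , ∈C)
        ... | inj₂ ∈C = inj₂ ((fst i , 𝔾.∼-sym a∼a′) , ∈C)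
      ... | inj₂ min≡ = record
        { C? = λ i → C? (fst i) ×-dec SymGraph.∂? ℍ.SR (snd i)
        ; cover = C×∂-cover
        ; size = trans (#-□ C? (SymGraph.∂? ℍ.SR)) (trans (cong (_* q) size) (trans (*-comm βᴳ q) (sym min≡)))
        ; minimal = lower-bound
        }
        where
        open SymGraph.CoverNumber coverᴳ
        C×∂-cover : SymGraph.Cover ℙ.SR λ i → C (fst i) × SymGraph.∂ ℍ.SR (snd i)
        C×∂-cover i j i∼j with ∼-□⁻ i j i∼j
        ... | a∼a′ , b∼b′ with cover (fst i) (fst j) a∼a′
        ... | inj₁ ∈C = inj₁ (∈C , (snd j , b∼b′))
        ... | inj₂ ∈C = inj₂ (∈C , (snd i , ℍ.∼-sym b∼b′))

theorem14 : (G H : Graph) → IsSimple G → IsSimple H →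
    2 ≤ n G → 2 ≤ n H →
    Connected G → Connected H →
    SRVertexTransitive G → SRVertexTransitive H →
    (dG dH : ℕ) → IsStrongMetricDim G dG → IsStrongMetricDim H dH →
    IsStrongMetricDim (G □ H) ((boundarySize G * dH) ⊓ (boundarySize H * dG))
theorem14 G H simpleᴳ simpleᴴ 2≤nᴳ 2≤nᴴ connectedᴳ connectedᴴ transitiveᴳ transitiveᴴ dG dH dimᴳ dimᴴ
  = subst₂ (λ p q → IsStrongMetricDim (G □ H) ((p * dH) ⊓ (q * dG)))
    (sym 𝔾.boundarySize≡) (sym ℍ.boundarySize≡) (ℙ.coverNumber⇒dim
    -- A loop in the strong resolving graph of the product would project to a loop in that of `G`.
    (λ i i∼i → 𝔾-irrefl _ (proj₁ (∼-□⁻ i i i∼i)))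
    (coverNumber-□ (𝔾.SR-transitive transitiveᴳ) (ℍ.SR-transitive transitiveᴴ)
      (𝔾.dim⇒coverNumber 𝔾-irrefl dimᴳ)
      (ℍ.dim⇒coverNumber (ℍ.∼-irreflexive (proj₂ simpleᴴ) 2≤nᴴ) dimᴴ)))
  where
  open □-StrongDimension G H simpleᴳ simpleᴴ (connected⇒isDistance connectedᴳ) (connected⇒isDistance connectedᴴ)
  𝔾-irrefl : ∀ a → ¬ (a 𝔾.∼ a)
  𝔾-irrefl = 𝔾.∼-irreflexive (proj₂ simpleᴳ) 2≤nᴳ
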